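{- Let $\mathcal M$ be a map on a surface with $n$ edges, with set of edges $E$ and set of coedges $E^*$. Put $\partial_0\mathcal M=\mathcal M$, and for $j\in\{1,\dots,n\}$ let $\partial_j\mathcal M$ be the partial dual of $\mathcal M$ with respect to the edge $j$. For $j\in\{0,1,\dots,n\}$ let $S_j$, $V_j$ and $V_j^*$ denote the underlying surface of $\partial_j\mathcal M$ and its sets of vertices and covertices, and let $$\mathcal H_j=H_1(S_j\setminus(V_j\cup V_j^*)),$$ homology being taken with coefficients in $\mathbb Q$. Let $\iota$ denote the incidence vector map from $\mathcal H_j$ to $\mathbb Q^E\oplus\mathbb Q^{E^*}$. Then the pair $(\iota(\mathcal H_0),\iota(\mathcal H_j))$ is a Lagrangian pair of subspaces of $\mathbb Q^E\oplus\mathbb Q^{E^*}$ whenever $j\neq 0$.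
   Context: A map $\mathcal M$ on a surface $S$ is a cellular embedding of a connected graph (loops and multiple edges allowed) into a connected, closed, orientable surface $S$, which is given the positive, counter-clockwise orientation; the components of the complement are the faces, each homeomorphic to an open 2-cell. The dual map $\mathcal M^*$ on $S$ has one vertex (covertex) in each face of $\mathcal M$, and for each edge $e$ an edge (coedge) $e^*$ joining the face-centres of the face(s) on the two sides of $e$, crossing $e$ exactly once and meeting no other edge of $\mathcal M$. $V,V^*,E,E^*$ denote the sets of vertices, covertices, edges and coedges. Cartographic description and partial dual: divide each edge into two half-edges and label the half-edges by $\{1,\dots,2n\}$, placing each label on the left when standing at a vertex and looking towards the adjacent edge midpoint. Then $\mathcal M$ is encoded by $\langle\sigma,\alpha,\varphi\rangle$, $\sigma,\alpha,\varphi\in S_{2n}$, where the disjoint cycles of $\sigma,\alpha,\varphi$ are the counter-clockwise cyclic orderings of labels around vertices, around edge midpoints, and within faces; $\alpha$ is a fixed-point free involution, $\sigma\alpha\varphi=1$, and the group generated is transitive; conversely such a triple determines a map up to isomorphism. Write $\alpha=c_1\cdots c_n$ as a product of disjoint transpositions, $c_j$ corresponding to the edge $j$. Then $\partial_j\mathcal M=\langle\sigma c_j,\alpha,c_j\varphi\rangle$. The edge of $\partial_j\mathcal M$ corresponding to $c_i$ is again labelled $i\in E$, and its coedge $i^*\in E^*$. Orthogonal space: $\mathbb Q^E\oplus\mathbb Q^{E^*}$ has basis $E\cup E^*$ and symmetric bilinear form with $\langle e,e^*\rangle=1$ and $\langle e,f\rangle=0$ whenever $f\ne e^*$ (where $e^{**}=e$).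 A Lagrangian subspace is a totally isotropic subspace of maximum dimension, namely $n$. Two Lagrangian subspaces form a Lagrangian pair (a pair of Lagrangian subspaces) if their intersection has dimension $n-1$. Incidence vectors: for a map on a surface $S$, orient the edges arbitrarily and orient each coedge $e^*$ so that it intersects $e$ from the right (after a counter-clockwise turn the orientation of $e$ coincides with that of $e^*$); the intersection index is then $(e,e^*)=1$, and it is $-1$ if $e^*$ intersects $e$ from the left. The intersection index extends to an intersection index $(c,e)$ of a class $c\in H_1(S\setminus(V\cup V^*))$ with each $e\in E\cup E^*$. The incidence vector of $c$ is $\iota(c)=\sum_{e\in E\cup E^*}(c,e)\,e\in\mathbb Q^E\oplus\mathbb Q^{E^*}$. The construction is applied to $\mathcal M$ and to each $\partial_j\mathcal M$ on its surface $S_j$, with values in the same space $\mathbb Q^E\oplus\mathbb Q^{E^*}$.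
   Formalization: The arbitrary edge orientations used for the incidence vectors of M and of its partial dual at j are required to agree on every edge other than j (same tail half-edge); for independently chosen orientations the claim fails. -}

module Defs where

open import Data.Bool.Base using (if_then_else_)
open import Data.Fin.Base using (Fin)
open import Data.Fin.Properties using (_≟_)
open import Data.Fin.Permutation
  using (Permutation′; permutation; _⟨$⟩ʳ_; _⟨$⟩ˡ_; _∘ₚ_; flip; inverseˡ; inverseʳ)
  renaming (id to idₚ; _≈_ to _≈ₚ_)
open import Data.Nat.Base as ℕ using (ℕ; suc)
open import Data.Product.Base using (Σ; ∃; ∃-syntax; _×_; _,_; proj₁; proj₂)
open import Data.Rational.Base using (ℚ; 0ℚ; _+_; _*_; _-_; -_)
open import Data.Rational.Properties
  using (+-0-commutativeMonoid; +-inverseʳ)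
open import Data.Rational.Solver using (module +-*-Solver)
open import Data.Sum.Base using (_⊎_; inj₁; inj₂)
open import Function.Base using (const)
open import Function.Bundles using (Func)
open import Function.Definitions using (StrictlySurjective)
open import Level using (0ℓ)
open import Relation.Binary.Bundles using (Setoid)
open import Relation.Binary.PropositionalEquality
open import Relation.Nullary.Decidable using (does; yes; no)
open import Relation.Nullary.Negation using (contradiction)
open import Relation.Unary using (Pred; _∩_)

open import Algebra.Properties.CommutativeMonoid.Sum +-0-commutativeMonoid
  using (sum)

------------------------------------------------------------------------
-- Linear algebra over ℚ
--
-- Vectors with coordinates indexed by I, compared pointwise (_≗_).

ℚ^_ : Set → Set
ℚ^ I = I → ℚ

module _ {I : Set} where

  linearCombination : ∀ {d} → (Fin d → ℚ) → (Fin d → ℚ^ I) → ℚ^ I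
  linearCombination a b x = sum (λ k → a k * b k x)

  record IsSubspace (W : Pred (ℚ^ I) 0ℓ) : Set where
    field
      resp-≗   : ∀ {u v} → u ≗ v → W u → W v
      0-closed : W (const 0ℚ)
      +-closed : ∀ {u v} → W u → W v → W (λ x → u x + v x)
      *-closed : ∀ a {v} → W v → W (λ x → a * v x)

  record IsBasis (W : Pred (ℚ^ I) 0ℓ) {d} (b : Fin d → ℚ^ I) : Set where
    field
      inside      : ∀ k → W (b k)
      independent : ∀ a → linearCombination a b ≗ const 0ℚ → ∀ k → a k ≡ 0ℚ
      spanning    : ∀ {v} → W v → ∃[ a ] linearCombination a b ≗ v

  HasDimension : Pred (ℚ^ I) 0ℓ → ℕ → Set
  HasDimension W d = Σ (Fin d → ℚ^ I) (IsBasis W)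

------------------------------------------------------------------------
-- The orthogonal space ℚ^E ⊕ ℚ^E*
--
-- Edges are numbered by Fin n.  In E ⊎ E*, inj₁ e is the edge e and
-- inj₂ e is its coedge e*.

E⊎E* : ℕ → Set
E⊎E* n = Fin n ⊎ Fin n

-- The bilinear extension of ⟨e,e*⟩ = ⟨e*,e⟩ = 1, all other pairs of
-- basis vectors having product 0.

⟪_,_⟫ : ∀ {n} → ℚ^ E⊎E* n → ℚ^ E⊎E* n → ℚ
⟪ u , v ⟫ = sum (λ e → u (inj₁ e) * v (inj₂ e) + u (inj₂ e) * v (inj₁ e))

TotallyIsotropic : ∀ {n} → Pred (ℚ^ E⊎E* n) 0ℓ → Set
TotallyIsotropic W = ∀ u v → W u → W v → ⟪ u , v ⟫ ≡ 0ℚ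

record IsLagrangian {n} (W : Pred (ℚ^ E⊎E* n) 0ℓ) : Set where
  field
    isSubspace       : IsSubspace W
    totallyIsotropic : TotallyIsotropic W
    dimension        : HasDimension W n

-- The dimension n - 1 is the d with suc d ≡ n, so that no pair
-- qualifies when n is 0.

record IsLagrangianPair {n} (W W′ : Pred (ℚ^ E⊎E* n) 0ℓ) : Set where
  field
    lagrangian₁  : IsLagrangian W
    lagrangian₂  : IsLagrangian W′
    intersection : ∃[ d ] (suc d ≡ n × HasDimension (W ∩ W′) d)

------------------------------------------------------------------------
-- Maps, described by permutations of the 2n half-edge labels
--
-- The label of a half-edge is written on its left, looking from its
-- vertex towards the edge midpoint.  The cycles of σ, α, φ are the
-- counter-clockwise orders of the labels around vertices, around edge
-- midpoints and within faces.  Products are read from left to right;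
-- with labels on the left this is the reading for which σαφ = 1.

data ⟨_,_,_⟩∋_ {m} (σ α φ : Permutation′ m) : Permutation′ m → Set where
  gen-σ   : ⟨ σ , α , φ ⟩∋ σ
  gen-α   : ⟨ σ , α , φ ⟩∋ α
  gen-φ   : ⟨ σ , α , φ ⟩∋ φ
  unit    : ⟨ σ , α , φ ⟩∋ idₚ
  product : ∀ {π ρ} → ⟨ σ , α , φ ⟩∋ π → ⟨ σ , α , φ ⟩∋ ρ → ⟨ σ , α , φ ⟩∋ (π ∘ₚ ρ)
  inverse : ∀ {π} → ⟨ σ , α , φ ⟩∋ π → ⟨ σ , α , φ ⟩∋ flip π

GeneratesTransitive : ∀ {m} (σ α φ : Permutation′ m) → Set
GeneratesTransitive σ α φ =
  ∀ d d′ → ∃[ π ] (⟨ σ , α , φ ⟩∋ π × π ⟨$⟩ʳ d ≡ d′)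

Label : ℕ → Set
Label n = Fin (2 ℕ.* n)

record Map (n : ℕ) : Set where
  field
    σ α φ          : Permutation′ (2 ℕ.* n)
    α-involutive   : ∀ d → α ⟨$⟩ʳ (α ⟨$⟩ʳ d) ≡ d
    α-noFixedPoint : ∀ d → α ⟨$⟩ʳ d ≢ d
    σαφ≈1          : (σ ∘ₚ α ∘ₚ φ) ≈ₚ idₚ
    transitive     : GeneratesTransitive σ α φ

    -- The numbering c₁, …, cₙ of the transpositions of α: edge d is
    -- the j such that d is moved by cⱼ.
    edge           : Label n → Fin n
    edge-α         : ∀ d → edge (α ⟨$⟩ʳ d) ≡ edge d
    edge-fibre     : ∀ d d′ → edge d ≡ edge d′ → d′ ≡ d ⊎ d′ ≡ α ⟨$⟩ʳ d
    edge-onto      : StrictlySurjective _≡_ edge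

  private
    cᶠ : Fin n → Label n → Label n
    cᶠ j d = if does (edge d ≟ j) then α ⟨$⟩ʳ d else d

    cᶠ-involutive : ∀ j d → cᶠ j (cᶠ j d) ≡ d
    cᶠ-involutive j d with edge d ≟ j
    ... | yes p with edge (α ⟨$⟩ʳ d) ≟ j
    ...   | yes _ = α-involutive d
    ...   | no ¬p = contradiction (trans (edge-α d) p) ¬p
    cᶠ-involutive j d | no ¬p with edge d ≟ j
    ...   | yes p = contradiction p ¬p
    ...   | no _ = refl

  -- cⱼ, as the permutation acting as α on the two labels of the edge j
  -- and fixing every other label.
  c : Fin n → Permutation′ (2 ℕ.* n)
  c j = permutation (cᶠ j) (cᶠ j) (cᶠ-involutive j) (cᶠ-involutive j)

  c-cases : ∀ j d → c j ⟨$⟩ʳ d ≡ d ⊎ c j ⟨$⟩ʳ d ≡ α ⟨$⟩ʳ d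
  c-cases j d with edge d ≟ j
  ... | yes _ = inj₂ refl
  ... | no _  = inj₁ refl

  c-α-c : ∀ j d → c j ⟨$⟩ʳ (α ⟨$⟩ʳ (c j ⟨$⟩ʳ d)) ≡ α ⟨$⟩ʳ d
  c-α-c j d with edge d ≟ j
  ... | yes p rewrite α-involutive d with edge d ≟ j
  ...   | yes _ = refl
  ...   | no ¬p = contradiction p ¬p
  c-α-c j d | no ¬p with edge (α ⟨$⟩ʳ d) ≟ j
  ...   | yes p = contradiction (trans (sym (edge-α d)) p) ¬p
  ...   | no _ = refl

------------------------------------------------------------------------
-- The partial dual ⟨ σcⱼ , α , cⱼφ ⟩ with respect to the edge j

module _ {n} (M : Map n) (j : Fin n) where
  open Map M

  private
    σ′ φ′ : Permutation′ (2 ℕ.* n)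
    σ′ = σ ∘ₚ c j
    φ′ = c j ∘ₚ φ

    Reach : Label n → Label n → Set
    Reach d d′ = ∃[ π ] (⟨ σ′ , α , φ′ ⟩∋ π × π ⟨$⟩ʳ d ≡ d′)

    reach-σ : ∀ d → Reach d (σ ⟨$⟩ʳ d)
    reach-σ d with c-cases j (σ ⟨$⟩ʳ d)
    ... | inj₁ p = σ′ , gen-σ , p
    ... | inj₂ p = σ′ ∘ₚ α , product gen-σ gen-α
                 , trans (cong (α ⟨$⟩ʳ_) p) (α-involutive _)

    c-involutive : ∀ d → c j ⟨$⟩ʳ (c j ⟨$⟩ʳ d) ≡ d
    c-involutive d = inverseˡ (c j)

    reach-φ : ∀ d → Reach d (φ ⟨$⟩ʳ d)
    reach-φ d with c-cases j d
    ... | inj₁ p = φ′ , gen-φ , cong (φ ⟨$⟩ʳ_) p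
    ... | inj₂ p = α ∘ₚ φ′ , product gen-α gen-φ
                 , cong (φ ⟨$⟩ʳ_) (trans (cong (c j ⟨$⟩ʳ_) (sym p)) (c-involutive d))

    reach : ∀ {π} → ⟨ σ , α , φ ⟩∋ π → ∀ d → Reach d (π ⟨$⟩ʳ d)
    reach gen-σ d = reach-σ d
    reach gen-α d = α , gen-α , refl
    reach gen-φ d = reach-φ d
    reach unit  d = idₚ , unit , refl
    reach (product {π} {ρ} p q) d
      with π₁ , p₁ , e₁ ← reach p d | ρ₁ , q₁ , e₂ ← reach q (π ⟨$⟩ʳ d)
      = π₁ ∘ₚ ρ₁ , product p₁ q₁ , trans (cong (ρ₁ ⟨$⟩ʳ_) e₁) e₂
    reach (inverse {π} p) d
      with π₁ , p₁ , e₁ ← reach p (π ⟨$⟩ˡ d)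
      = flip π₁ , inverse p₁
      , trans (cong (π₁ ⟨$⟩ˡ_) (sym (trans e₁ (inverseʳ π)))) (inverseˡ π₁)

  partialDual : Map n
  partialDual = record
    { σ = σ′ ; α = α ; φ = φ′
    ; α-involutive = α-involutive
    ; α-noFixedPoint = α-noFixedPoint
    ; σαφ≈1 = λ d → trans (cong (φ ⟨$⟩ʳ_) (c-α-c j (σ ⟨$⟩ʳ d))) (σαφ≈1 d)
    ; transitive = λ d d′ →
        let π , p , e    = transitive d d′
            π′ , p′ , e′ = reach p d
        in π′ , p′ , trans e′ e
    ; edge = edge
    ; edge-α = edge-α
    ; edge-fibre = edge-fibre
    ; edge-onto = edge-onto
    }

------------------------------------------------------------------------
-- Orientations
--
-- An edge is oriented by choosing the half-edge at its tail.  The coedge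
-- e* is then oriented so that it crosses e from right to left.

record Orientation {n} (M : Map n) : Set where
  open Map M
  field
    tail      : Fin n → Label n
    edge-tail : ∀ e → edge (tail e) ≡ e

------------------------------------------------------------------------
-- H₁(S ∖ (V ∪ V*)), with coefficients in ℚ
--
-- The edges and coedges cut S into one quadrilateral (corner) per label
-- d: the corner to the left of the half-edge d, which is bounded by the
-- half-edges d and σ d and contains the point where d is written.
-- S ∖ (V ∪ V*) deformation retracts onto the following 2-complex, dual to
-- this decomposition; the 2-cells dual to V and V* are the missing ones.
--
--   0-cells: the corners d.
--   1-cells: around-vertex d, crossing the half-edge d from right to left,
--              from the corner σ⁻¹ d to the corner d;
--            around-face d, crossing the half-coedge to the left of the
--              half-edge d, in the direction of d, from the corner d to
--              the corner φ d.
--   2-cells: one around each edge midpoint.  If d is a label of the edge,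
--            the boundary goes once around the midpoint, clockwise, along
--            around-face d, around-vertex (α d), around-face (α d),
--            around-vertex d, each of them in its own direction.
--
-- Its homology is the cellular homology below.

module _ {n} (M : Map n) where
  open Map M

  Cell₁ : Set
  Cell₁ = Label n ⊎ Label n

  pattern around-vertex d = inj₁ d
  pattern around-face   d = inj₂ d

  -- The coefficient at a corner d: the 1-cells ending at d count
  -- positively and those starting at d negatively.
  ∂₁ : ℚ^ Cell₁ → ℚ^ Label n
  ∂₁ z d = (z (around-vertex d) - z (around-vertex (σ ⟨$⟩ʳ d)))
         + (z (around-face (φ ⟨$⟩ˡ d)) - z (around-face d))

  ∂₂ : ℚ^ Fin n → ℚ^ Cell₁
  ∂₂ t (around-vertex d) = t (edge d)
  ∂₂ t (around-face d)   = t (edge d)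

  private
    edge-φ⁻¹ : ∀ d → edge (φ ⟨$⟩ˡ d) ≡ edge (σ ⟨$⟩ʳ d)
    edge-φ⁻¹ d = trans
      (cong edge (trans (cong (φ ⟨$⟩ˡ_) (sym (σαφ≈1 d))) (inverseˡ φ)))
      (edge-α _)

  ∂₁∂₂≗0 : ∀ t → ∂₁ (∂₂ t) ≗ const 0ℚ
  ∂₁∂₂≗0 t d = trans
    (cong (λ e → (t (edge d) - t (edge (σ ⟨$⟩ʳ d))) + (t e - t (edge d))) (edge-φ⁻¹ d))
    (solve 2 (λ x y → (x :- y) :+ (y :- x) := con 0ℚ) refl
       (t (edge d)) (t (edge (σ ⟨$⟩ʳ d))))
    where open +-*-Solver

  Cycle : Set
  Cycle = Σ (ℚ^ Cell₁) (λ z → ∂₁ z ≗ const 0ℚ)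

  Homologous : Cycle → Cycle → Set
  Homologous (z , _) (z′ , _) = ∃[ t ] ((λ a → z a - z′ a) ≗ ∂₂ t)

  private
    hom-refl : ∀ {z} → Homologous z z
    hom-refl {z , _} = const 0ℚ ,
      λ { (inj₁ d) → +-inverseʳ (z (inj₁ d)) ; (inj₂ d) → +-inverseʳ (z (inj₂ d)) }

    hom-sym : ∀ {z z′} → Homologous z z′ → Homologous z′ z
    hom-sym {z , _} {z′ , _} (t , p) = (λ e → - t e) ,
      λ { (inj₁ d) → trans (neg (z (inj₁ d)) (z′ (inj₁ d))) (cong -_ (p (inj₁ d)))
        ; (inj₂ d) → trans (neg (z (inj₂ d)) (z′ (inj₂ d))) (cong -_ (p (inj₂ d))) }
      where
      open +-*-Solver
      neg : ∀ x y → y - x ≡ - (x - y)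
      neg = solve 2 (λ x y → y :- x := :- (x :- y)) refl

    hom-trans : ∀ {z z′ z″} → Homologous z z′ → Homologous z′ z″ → Homologous z z″
    hom-trans {z , _} {z′ , _} {z″ , _} (t , p) (s , q) = (λ e → t e + s e) ,
      λ { (inj₁ d) → step (inj₁ d) (p (inj₁ d)) (q (inj₁ d))
        ; (inj₂ d) → step (inj₂ d) (p (inj₂ d)) (q (inj₂ d)) }
      where
      open +-*-Solver
      step : ∀ a {x y} → z a - z′ a ≡ x → z′ a - z″ a ≡ y → z a - z″ a ≡ x + y
      step a refl refl =
        solve 3 (λ x y w → x :- w := (x :- y) :+ (y :- w)) refl (z a) (z′ a) (z″ a)

  H₁ : Setoid 0ℓ 0ℓ
  H₁ = record
    { Carrier = Cycle
    ; _≈_ = Homologous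
    ; isEquivalence = record
      { refl  = λ {z} → hom-refl {z}
      ; sym   = λ {z} {z′} → hom-sym {z} {z′}
      ; trans = λ {z} {z′} {z″} → hom-trans {z} {z′} {z″}
      }
    }

  ----------------------------------------------------------------------
  -- Incidence vectors
  --
  -- The index (z, e) counts a crossing of e by z from left to right as +1;
  -- this is the sign for which (e, e*) = 1 when e* crosses e from right to
  -- left.  If d is the tail of e, then around-vertex d crosses e from
  -- right to left and around-vertex (α d) crosses it from left to right.
  -- Likewise around-face d runs parallel to e and crosses e* from left to
  -- right, while around-face (α d) runs the opposite way.

  module _ (o : Orientation M) where
    open Orientation o

    index : ℚ^ Cell₁ → E⊎E* n → ℚ
    index z (inj₁ e) = z (around-vertex (α ⟨$⟩ʳ tail e)) - z (around-vertex (tail e))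
    index z (inj₂ e) = z (around-face (tail e)) - z (around-face (α ⟨$⟩ʳ tail e))

    private
      index-cong : ∀ {z z′} → Homologous z z′ → index (proj₁ z) ≗ index (proj₁ z′)
      index-cong {z , _} {z′ , _} (t , p) = λ
        { (inj₁ e) → lemma (inj₁ (α ⟨$⟩ʳ tail e)) (inj₁ (tail e))
                       (p _) (p _) (cong t (edge-α (tail e)))
        ; (inj₂ e) → lemma (inj₂ (tail e)) (inj₂ (α ⟨$⟩ʳ tail e))
                       (p _) (p _) (cong t (sym (edge-α (tail e)))) }
        where
        open +-*-Solver
        lemma : ∀ a b {x y} → z a - z′ a ≡ x → z b - z′ b ≡ y → x ≡ y →
                z a - z b ≡ z′ a - z′ b
        lemma a b {x} {y} p q r = begin
          z a - z b
            ≡⟨ solve 4 (λ u v u′ v′ → u :- v :=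
                 (u′ :- v′) :+ ((u :- u′) :- (v :- v′))) refl
                 (z a) (z b) (z′ a) (z′ b) ⟩
          (z′ a - z′ b) + ((z a - z′ a) - (z b - z′ b))
            ≡⟨ cong₂ (λ u v → (z′ a - z′ b) + (u - v)) (trans p r) q ⟩
          (z′ a - z′ b) + (y - y)
            ≡⟨ solve 2 (λ u v → u :+ (v :- v) := u) refl (z′ a - z′ b) y ⟩
          z′ a - z′ b ∎
          where open ≡-Reasoning

    ι : Func H₁ (E⊎E* n →-setoid ℚ)
    ι = record
      { to   = λ z → index (proj₁ z)
      ; cong = λ {z} {z′} → index-cong {z} {z′}
      }

    -- The image ι(H₁).
    ι[H₁] : Pred (ℚ^ E⊎E* n) 0ℓ
    ι[H₁] v = ∃[ z ] Func.to ι z ≗ v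

------------------------------------------------------------------------
-- Common orientations of M and of its partial dual
--
-- M and partialDual M j have the same labels and edges, and the incidence
-- vectors of both lie in the same space, so the orientations have to be
-- matched: every edge other than j has the same tail in both.  The edge j,
-- whose neighbourhood is altered, may be oriented either way in each.

AgreeAwayFrom : ∀ {n} {M M′ : Map n} → Fin n → Orientation M → Orientation M′ → Set
AgreeAwayFrom j o o′ = ∀ e → e ≢ j → Orientation.tail o′ e ≡ Orientation.tail o e

{-# OPTIONS --safe #-}

-- For a cycle z put h(d) = z(around-vertex d) − z(around-face d).  Then h
-- satisfies h(d) + h(αd) = h(σ⁻¹d) + h(σ⁻¹αd) for every label d ("h is
-- balanced"), the incidence vector of z has the coordinates
--   x_e = h(αt) − h(σ⁻¹t),  y_e = h(σ⁻¹t) − h(t),  t the tail of e,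
-- and every balanced h arises in this way.
--
-- Isotropy: for balanced h and h′, with g = h h′,
--   x y′ + y x′ = g(t) + g(αt) − g(σ⁻¹t) − g(σ⁻¹αt),
-- and the sum of this over all edges telescopes.
--
-- Dimension: the n balance conditions have exactly one linear relation,
-- their sum, and incidence vectors determine h up to a constant, so the
-- image has dimension 2n − (n − 1) − 1 = n.
--
-- The partial dual has the same balanced functions, and its incidence
-- vectors differ only at j, where (x, y) becomes (y, x) or (−y, −x) depending
-- on the orientations.  If a vector lies in both images, isotropy forces
-- (x ∓ y)² = 0 at j; conversely x = ±y makes the two incidence vectors of h
-- equal.  So the intersection is cut out by one more equation h(u) = h(u′),
-- which is independent of the others.
module Submission where

open import Defs
open import Algebra.Bundles using (CommutativeRing)
open import Data.Fin.Base using (Fin; zero; suc; punchIn)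
open import Data.Fin.Permutation using (Permutation′; _⟨$⟩ʳ_; _⟨$⟩ˡ_; flip; inverseˡ; inverseʳ)
open import Data.Fin.Properties using (_≟_; any?; punchInᵢ≢i)
open import Data.Nat.Base as ℕ using (ℕ; zero; suc)
open import Data.Nat.Properties as ℕ using ()
open import Data.Product.Base using (∃-syntax; _×_; _,_; proj₁; proj₂)
open import Data.Rational.Base
  using (ℚ; 0ℚ; 1ℚ; ½; _+_; _*_; _-_; -_; 1/_; _≤_; ∣_∣; ≢-nonZero)
open import Data.Rational.Properties as ℚ using (+-*-commutativeRing)
open import Data.Rational.Solver using (module +-*-Solver)
open import Data.Sum.Base using (_⊎_; inj₁; inj₂)
open import Data.Unit.Base using (⊤)
open import Data.Vec.Functional using (insertAt)
open import Data.Vec.Functional.Properties using (insertAt-lookup; insertAt-punchIn)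
open import Function.Base using (_∘_; const)
open import Level using (0ℓ)
open import Relation.Binary.PropositionalEquality
open import Relation.Nullary.Decidable using (Dec; yes; no; ¬?; decidable-stable)
open import Relation.Nullary.Negation using (contradiction)
open import Relation.Unary using (Pred; _∩_)

open import Algebra.Properties.Group ℚ.+-0-group using (x∙y⁻¹≈ε⇒x≈y)
open import Algebra.Properties.Semiring.Sum (CommutativeRing.semiring +-*-commutativeRing)
open +-*-Solver using (solve; _:+_; _:*_; _:-_; :-_; _:=_; con)
open ≡-Reasoning


-- Rational numbers and finite sums

sum-zero : ∀ {n} {f : Fin n → ℚ} → (∀ i → f i ≡ 0ℚ) → sum f ≡ 0ℚ
sum-zero {n} p = trans (sum-cong-≗ p) (sum-replicate-zero n)

sum-single : ∀ {n} (k : Fin n) {f : Fin n → ℚ} → (∀ i → i ≢ k → f i ≡ 0ℚ) → sum f ≡ f k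
sum-single {suc n} k {f} p = begin
  sum f                         ≡⟨ sum-remove {i = k} f ⟩
  f k + sum (f ∘ punchIn k)     ≡⟨ cong (f k +_) (sum-zero (λ i → p _ (punchInᵢ≢i k i))) ⟩
  f k + 0ℚ                      ≡⟨ ℚ.+-identityʳ _ ⟩
  f k                           ∎

δ : ∀ {n} → Fin n → Fin n → ℚ
δ i k with i ≟ k
... | yes _ = 1ℚ
... | no _  = 0ℚ

δ-same : ∀ {n} (i : Fin n) → δ i i ≡ 1ℚ
δ-same i with i ≟ i
... | yes _ = refl
... | no ¬p = contradiction refl ¬p

δ-distinct : ∀ {n} {i k : Fin n} → i ≢ k → δ i k ≡ 0ℚ
δ-distinct {i = i} {k} i≢k with i ≟ k
... | yes p = contradiction p i≢k
... | no _  = refl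

sum-δ : ∀ {n} (k : Fin n) (f : Fin n → ℚ) → sum (λ i → δ k i * f i) ≡ f k
sum-δ k f = begin
  sum (λ i → δ k i * f i)  ≡⟨ sum-single k (λ i i≢k → trans
                                (cong (_* f i) (δ-distinct (i≢k ∘ sym))) (ℚ.*-zeroˡ (f i))) ⟩
  δ k k * f k              ≡⟨ cong (_* f k) (δ-same k) ⟩
  1ℚ * f k                 ≡⟨ ℚ.*-identityˡ (f k) ⟩
  f k                      ∎

reciprocal : ∀ {q} → q ≢ 0ℚ → ∃[ r ] r * q ≡ 1ℚ
reciprocal {q} q≢0 = 1/ q , ℚ.*-inverseˡ q
  where instance _ = ≢-nonZero q≢0

x*y≡0⇒y≡0 : ∀ {x y} → x ≢ 0ℚ → x * y ≡ 0ℚ → y ≡ 0ℚ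
x*y≡0⇒y≡0 {x} {y} x≢0 xy≡0 with r , rx≡1 ← reciprocal x≢0 = begin
  y            ≡⟨ sym (ℚ.*-identityˡ y) ⟩
  1ℚ * y       ≡⟨ cong (_* y) (sym rx≡1) ⟩
  r * x * y    ≡⟨ ℚ.*-assoc r x y ⟩
  r * (x * y)  ≡⟨ cong (r *_) xy≡0 ⟩
  r * 0ℚ       ≡⟨ ℚ.*-zeroʳ r ⟩
  0ℚ           ∎

x*x≡0⇒x≡0 : ∀ {x} → x * x ≡ 0ℚ → x ≡ 0ℚ
x*x≡0⇒x≡0 {x} p = decidable-stable (x ℚ.≟ 0ℚ) (λ x≢0 → x≢0 (x*y≡0⇒y≡0 x≢0 p))

x-y≡0⇒x≡y : ∀ {x y} → x - y ≡ 0ℚ → x ≡ y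
x-y≡0⇒x≡y = x∙y⁻¹≈ε⇒x≈y _ _

x≡y⇒x-y≡0 : ∀ {x y} → x ≡ y → x - y ≡ 0ℚ
x≡y⇒x-y≡0 {x} refl = ℚ.+-inverseʳ x

sum-minus : ∀ {n} (f g : Fin n → ℚ) → sum (λ i → f i - g i) ≡ sum f - sum g
sum-minus {zero}  f g = refl
sum-minus {suc n} f g = trans (cong (f zero - g zero +_) (sum-minus (f ∘ suc) (g ∘ suc)))
  (solve 4 (λ a b c d → (a :- b) :+ (c :- d) := (a :+ c) :- (b :+ d)) refl
    (f zero) (g zero) (sum (f ∘ suc)) (sum (g ∘ suc)))

-- Reindexing by the inverse of `π` does not change the sum of `f`. For `π = σ` this is the
-- telescoping around the vertices.
sum-telescope : ∀ {m} (π : Permutation′ m) (f : Fin m → ℚ) → sum (λ d → f d - f (π ⟨$⟩ˡ d)) ≡ 0ℚ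
sum-telescope π f = trans (sum-minus f (λ d → f (π ⟨$⟩ˡ d)))
  (x≡y⇒x-y≡0 (sum-permute f (flip π)))

0≤x*x : ∀ x → 0ℚ ≤ x * x
0≤x*x x = subst (0ℚ ≤_) ∣x*x∣≡x*x (ℚ.0≤∣p∣ (x * x))
  where
  ∣x*x∣≡x*x : ∣ x * x ∣ ≡ x * x
  ∣x*x∣≡x*x with ℚ.∣p∣≡p∨∣p∣≡-p x
  ... | inj₁ p = trans (ℚ.∣p*q∣≡∣p∣*∣q∣ x x) (cong₂ _*_ p p)
  ... | inj₂ p = trans (ℚ.∣p*q∣≡∣p∣*∣q∣ x x) (trans (cong₂ _*_ p p)
                   (solve 1 (λ x → :- x :* :- x := x :* x) refl x))

sum-squares-nonneg : ∀ {n} (f : Fin n → ℚ) → 0ℚ ≤ sum (λ i → f i * f i)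
sum-squares-nonneg {zero}  f = ℚ.≤-refl
sum-squares-nonneg {suc n} f = ℚ.+-mono-≤ (0≤x*x (f zero)) (sum-squares-nonneg (f ∘ suc))

-- The order of ℚ enters here: the remaining squares have a non-negative sum, so each single square
-- is at most 0.
sum-squares≡0 : ∀ {n} (f : Fin n → ℚ) → sum (λ i → f i * f i) ≡ 0ℚ → ∀ i → f i ≡ 0ℚ
sum-squares≡0 {suc n} f p i = x*x≡0⇒x≡0 (ℚ.≤-antisym fᵢ²≤0 (0≤x*x (f i)))
  where
  fᵢ²≤0 : f i * f i ≤ 0ℚ
  fᵢ²≤0 = subst₂ _≤_ (ℚ.+-identityʳ (f i * f i))
    (trans (sym (sum-remove {i = i} (λ k → f k * f k))) p)
    (ℚ.+-monoʳ-≤ (f i * f i) (sum-squares-nonneg (f ∘ punchIn i)))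

-- Linear algebra over ℚ

module _ {I : Set} where

  record IsLinear (f : ℚ^ I → ℚ) : Set where
    field
      preserves-≗   : ∀ {u v} → u ≗ v → f u ≡ f v
      +-homo : ∀ u v → f (λ x → u x + v x) ≡ f u + f v
      *-homo : ∀ a v → f (λ x → a * v x) ≡ a * f v

    0-homo : f (const 0ℚ) ≡ 0ℚ
    0-homo = trans (*-homo 0ℚ (const 0ℚ)) (ℚ.*-zeroˡ (f (const 0ℚ)))

    combination-homo : ∀ {d} a (b : Fin d → ℚ^ I) →
      f (linearCombination a b) ≡ sum (λ k → a k * f (b k))
    combination-homo {zero}  a b = 0-homo
    combination-homo {suc d} a b = trans (+-homo _ (linearCombination (a ∘ suc) (b ∘ suc)))
      (cong₂ _+_ (*-homo (a zero) (b zero)) (combination-homo (a ∘ suc) (b ∘ suc)))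

  eval-linear : ∀ x → IsLinear (λ v → v x)
  eval-linear x = record { preserves-≗ = λ p → p x ; +-homo = λ _ _ → refl ; *-homo = λ _ _ → refl }

  zero-linear : IsLinear (const 0ℚ)
  zero-linear = record
    { preserves-≗ = λ _ → refl ; +-homo = λ _ _ → refl ; *-homo = λ a _ → sym (ℚ.*-zeroʳ a) }

  +-linear : ∀ {f g} → IsLinear f → IsLinear g → IsLinear (λ v → f v + g v)
  +-linear {f} {g} F G = record
    { preserves-≗   = λ p → cong₂ _+_ (F.preserves-≗ p) (G.preserves-≗ p)
    ; +-homo = λ u v → trans (cong₂ _+_ (F.+-homo u v) (G.+-homo u v))
        (solve 4 (λ a b c d → (a :+ b) :+ (c :+ d) := (a :+ c) :+ (b :+ d)) refl (f u) (f v) (g u) (g v))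
    ; *-homo = λ a v → trans (cong₂ _+_ (F.*-homo a v) (G.*-homo a v)) (sym (ℚ.*-distribˡ-+ a (f v) (g v)))
    }
    where
    module F = IsLinear F
    module G = IsLinear G

  scale-linear : ∀ c {f} → IsLinear f → IsLinear (λ v → c * f v)
  scale-linear c {f} F = record
    { preserves-≗   = λ p → cong (c *_) (F.preserves-≗ p)
    ; +-homo = λ u v → trans (cong (c *_) (F.+-homo u v)) (ℚ.*-distribˡ-+ c (f u) (f v))
    ; *-homo = λ a v → trans (cong (c *_) (F.*-homo a v))
        (solve 3 (λ c a x → c :* (a :* x) := a :* (c :* x)) refl c a (f v))
    }
    where module F = IsLinear F

  neg-linear : ∀ {f} → IsLinear f → IsLinear (λ v → - f v)
  neg-linear {f} F = record
    { preserves-≗   = λ p → cong -_ (F.preserves-≗ p)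
    ; +-homo = λ u v → trans (cong -_ (F.+-homo u v)) (ℚ.neg-distrib-+ (f u) (f v))
    ; *-homo = λ a v → trans (cong -_ (F.*-homo a v)) (ℚ.neg-distribʳ-* a (f v))
    }
    where module F = IsLinear F

  sum-linear : ∀ {m} {f : Fin m → ℚ^ I → ℚ} → (∀ i → IsLinear (f i)) → IsLinear (λ v → sum (λ i → f i v))
  sum-linear {zero}  F = zero-linear
  sum-linear {suc m} F = +-linear (F zero) (sum-linear (F ∘ suc))

  basis-resp : ∀ {P Q : Pred (ℚ^ I) 0ℓ} → (∀ {v} → P v → Q v) → (∀ {v} → Q v → P v) →
    ∀ {d} → HasDimension P d → HasDimension Q d
  basis-resp P⊆Q Q⊆P (b , B) = b , record
    { inside = P⊆Q ∘ inside ; independent = independent ; spanning = spanning ∘ Q⊆P }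
    where open IsBasis B

  kernel-subspace : ∀ {P : Pred (ℚ^ I) 0ℓ} {f} → IsSubspace P → IsLinear f →
    IsSubspace (P ∩ λ v → f v ≡ 0ℚ)
  kernel-subspace P-sub F = record
    { resp-≗   = λ p (Pu , fu≡0) → resp-≗ p Pu , trans (sym (preserves-≗ p)) fu≡0
    ; 0-closed = 0-closed , 0-homo
    ; +-closed = λ {u} {v} (Pu , fu≡0) (Pv , fv≡0) → +-closed Pu Pv ,
        trans (+-homo u v) (cong₂ _+_ fu≡0 fv≡0)
    ; *-closed = λ a {v} (Pv , fv≡0) → *-closed a Pv ,
        trans (*-homo a v) (trans (cong (a *_) fv≡0) (ℚ.*-zeroʳ a))
    }
    where
    open IsSubspace P-sub
    open IsLinear F

  -- With `r` the inverse of `f u`, the argument of `f` is the projection of `v` along `u` onto the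
  -- kernel.
  eliminated : ∀ {f u r} → IsLinear f → r * f u ≡ 1ℚ → ∀ v → f (λ x → v x + (- (f v * r)) * u x) ≡ 0ℚ
  eliminated {f} {u} {r} F rfu≡1 v = begin
    f (λ x → v x + (- (f v * r)) * u x)
      ≡⟨ +-homo _ _ ⟩
    f v + f (λ x → (- (f v * r)) * u x)
      ≡⟨ cong (f v +_) (*-homo (- (f v * r)) u) ⟩
    f v + (- (f v * r)) * f u
      ≡⟨ solve 3 (λ p r q → p :+ (:- (p :* r)) :* q := p :- p :* (r :* q)) refl (f v) r (f u) ⟩
    f v - f v * (r * f u)
      ≡⟨ cong (λ y → f v - f v * y) rfu≡1 ⟩
    f v - f v * 1ℚ
      ≡⟨ solve 1 (λ p → p :- p :* con 1ℚ := con 0ℚ) refl (f v) ⟩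
    0ℚ ∎
    where open IsLinear F

  module _ {P : Pred (ℚ^ I) 0ℓ} (P-sub : IsSubspace P) {d} {b : Fin (suc d) → ℚ^ I} (P-basis : IsBasis P b)
           {f : ℚ^ I → ℚ} (f-linear : IsLinear f) (k : Fin (suc d)) where
    open IsSubspace P-sub
    open IsBasis P-basis
    open IsLinear f-linear

    -- Gaussian elimination with pivot `b k`: every other basis vector is projected along `b k` into
    -- the kernel, and `b k` itself is dropped.
    kernel-dimension : f (b k) ≢ 0ℚ → HasDimension (P ∩ λ v → f v ≡ 0ℚ) d
    kernel-dimension fbₖ≢0 with r , r*fbₖ≡1 ← reciprocal fbₖ≢0 = b′ , record
      { inside = λ i → +-closed (inside _) (*-closed (c i) (inside k)) ,
          eliminated {u = b k} f-linear r*fbₖ≡1 (bₚ i)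
      ; independent = λ a p i →
          -- The entry inserted at `k` is the total coefficient that `b k` acquires when the vectors
          -- `b′ i` are expanded.
          let A = insertAt a k (sum (λ i → a i * c i))
              A≗0 = independent A λ x → begin
                linearCombination A b x
                  ≡⟨ split A x ⟩
                A k * b k x + linearCombination (A ∘ punchIn k) bₚ x
                  ≡⟨ cong₂ (λ y z → y * b k x + z) (insertAt-lookup a k _)
                       (sum-cong-≗ λ i → cong (_* bₚ i x) (insertAt-punchIn a k _ i)) ⟩
                sum (λ i → a i * c i) * b k x + linearCombination a bₚ x
                  ≡⟨ sym (combination′ a x) ⟩
                linearCombination a b′ x
                  ≡⟨ p x ⟩
                0ℚ ∎
          in trans (sym (insertAt-punchIn a k _ i)) (A≗0 (punchIn k i))
      ; spanning = λ {v} (Pv , fv≡0) →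
          let A , p = spanning Pv
              a = A ∘ punchIn k
              s = sum (λ i → a i * f (bₚ i))
              relation : A k * f (b k) + s ≡ 0ℚ
              relation = begin
                A k * f (b k) + s               ≡⟨ sym (sum-remove {i = k} (λ i → A i * f (b i))) ⟩
                sum (λ i → A i * f (b i))       ≡⟨ sym (combination-homo A b) ⟩
                f (linearCombination A b)       ≡⟨ preserves-≗ p ⟩
                f v                             ≡⟨ fv≡0 ⟩
                0ℚ                              ∎
              -- Since `f v` is 0, the coefficient of `b k` in `v` is determined by the others, and
              -- it is the one that the vectors `b′ i` produce.
              pivot : sum (λ i → a i * c i) ≡ A k
              pivot = begin
                sum (λ i → a i * c i)
                  ≡⟨ sum-cong-≗ (λ i → solve 3 (λ x y r → x :* (:- (y :* r)) := (:- r) :* (x :* y)) refl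
                       (a i) (f (bₚ i)) r) ⟩
                sum (λ i → - r * (a i * f (bₚ i)))
                  ≡⟨ sym (*-distribˡ-sum (- r) (λ i → a i * f (bₚ i))) ⟩
                - r * s
                  ≡⟨ solve 4 (λ r s A q → (:- r) :* s := A :* (r :* q) :- r :* (A :* q :+ s)) refl
                       r s (A k) (f (b k)) ⟩
                A k * (r * f (b k)) - r * (A k * f (b k) + s)
                  ≡⟨ cong₂ (λ y z → A k * y - r * z) r*fbₖ≡1 relation ⟩
                A k * 1ℚ - r * 0ℚ
                  ≡⟨ solve 2 (λ A r → A :* con 1ℚ :- r :* con 0ℚ := A) refl (A k) r ⟩
                A k ∎
          in a , λ x → begin
            linearCombination a b′ x
              ≡⟨ combination′ a x ⟩
            sum (λ i → a i * c i) * b k x + linearCombination a bₚ x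
              ≡⟨ cong (λ y → y * b k x + linearCombination a bₚ x) pivot ⟩
            A k * b k x + linearCombination a bₚ x
              ≡⟨ sym (split A x) ⟩
            linearCombination A b x
              ≡⟨ p x ⟩
            v x ∎
      }
      where
      bₚ : Fin d → ℚ^ I
      bₚ i = b (punchIn k i)

      c : Fin d → ℚ
      c i = - (f (bₚ i) * r)

      b′ : Fin d → ℚ^ I
      b′ i x = bₚ i x + c i * b k x

      split : ∀ A x → linearCombination A b x ≡ A k * b k x + linearCombination (A ∘ punchIn k) bₚ x
      split A x = sum-remove {i = k} (λ i → A i * b i x)

      combination′ : ∀ a x →
        linearCombination a b′ x ≡ sum (λ i → a i * c i) * b k x + linearCombination a bₚ x
      combination′ a x = begin
        sum (λ i → a i * (bₚ i x + c i * b k x))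
          ≡⟨ sum-cong-≗ (λ i → solve 4 (λ a p c q → a :* (p :+ c :* q) := a :* c :* q :+ a :* p) refl
               (a i) (bₚ i x) (c i) (b k x)) ⟩
        sum (λ i → a i * c i * b k x + a i * bₚ i x)
          ≡⟨ ∑-distrib-+ (λ i → a i * c i * b k x) (λ i → a i * bₚ i x) ⟩
        sum (λ i → a i * c i * b k x) + linearCombination a bₚ x
          ≡⟨ cong (_+ linearCombination a bₚ x) (sym (*-distribʳ-sum (b k x) (λ i → a i * c i))) ⟩
        sum (λ i → a i * c i) * b k x + linearCombination a bₚ x ∎

  -- This is independence of the restrictions to `P`, a form that can be passed on to the kernel of
  -- one of the functionals.
  IndependentOn : Pred (ℚ^ I) 0ℓ → ∀ {m} → (Fin m → ℚ^ I → ℚ) → Set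
  IndependentOn P {m} f = ∀ (t : Fin m → ℚ) → (∀ {v} → P v → sum (λ i → t i * f i v) ≡ 0ℚ) → ∀ i → t i ≡ 0ℚ

  -- Induction on the number of functionals: each one takes a pivot out of the current basis and
  -- lowers the dimension by one.
  common-kernel-dimension : ∀ m {d} {P : Pred (ℚ^ I) 0ℓ} → IsSubspace P → HasDimension P (m ℕ.+ d) →
    (f : Fin m → ℚ^ I → ℚ) → (∀ i → IsLinear (f i)) → IndependentOn P f →
    HasDimension (P ∩ λ v → ∀ i → f i v ≡ 0ℚ) d
  common-kernel-dimension zero P-sub P-dim f F f-ind = basis-resp (λ p → p , λ ()) proj₁ P-dim
  common-kernel-dimension (suc m) {P = P} P-sub (b , B) f F f-ind
    with any? (λ k → ¬? (f zero (b k) ℚ.≟ 0ℚ))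
  -- Without a pivot, `f zero` vanishes on a basis and hence on `P`, so that `δ zero` is a
  -- nontrivial relation.
  ... | no ¬∃ = contradiction (f-ind (δ zero) vanish zero) (λ p → ℚ.1≢0 (trans (sym (δ-same {suc m} zero)) p))
    where
    vanish : ∀ {v} → P v → sum (λ i → δ zero i * f i v) ≡ 0ℚ
    vanish {v} Pv with a , p ← IsBasis.spanning B Pv = begin
      sum (λ i → δ zero i * f i v)          ≡⟨ sum-δ zero (λ i → f i v) ⟩
      f zero v                              ≡⟨ preserves-≗ (λ x → sym (p x)) ⟩
      f zero (linearCombination a b)        ≡⟨ combination-homo a b ⟩
      sum (λ k → a k * f zero (b k))        ≡⟨ sum-zero (λ k → trans (cong (a k *_)
        (decidable-stable (f zero (b k) ℚ.≟ 0ℚ) (λ q → ¬∃ (k , q)))) (ℚ.*-zeroʳ (a k))) ⟩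
      0ℚ                                    ∎
      where open IsLinear (F zero)
  ... | yes (k , q≢0) = basis-resp
    (λ ((Pv , p) , ps) → Pv , λ { zero → p ; (suc i) → ps i })
    (λ (Pv , ps) → (Pv , ps zero) , ps ∘ suc)
    (common-kernel-dimension m (kernel-subspace P-sub (F zero)) (kernel-dimension P-sub B (F zero) k q≢0)
      (f ∘ suc) (F ∘ suc) (λ t p i → f-ind (extend t) (extended t p) (suc i)))
    where
    r = proj₁ (reciprocal q≢0)
    open IsSubspace P-sub

    -- A relation t among the other functionals on ker f₀ becomes a relation
    -- on P after adding a multiple of f₀.
    module _ (t : Fin m → ℚ) where
      g : ℚ^ I → ℚ
      g v = sum (λ i → t i * f (suc i) v)

      s : ℚ
      s = - (g (b k) * r)

      extend : Fin (suc m) → ℚ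
      extend zero    = s
      extend (suc i) = t i

      module G = IsLinear (sum-linear (λ i → scale-linear (t i) (F (suc i))))

      extended : (∀ {v} → P v × f zero v ≡ 0ℚ → g v ≡ 0ℚ) → ∀ {v} → P v → s * f zero v + g v ≡ 0ℚ
      extended p {v} Pv = begin
        s * f zero v + g v
          ≡⟨ solve 4 (λ y z r w → (:- (y :* r)) :* z :+ w := w :+ (:- (z :* r)) :* y) refl
               (g (b k)) (f zero v) r (g v) ⟩
        g v + c * g (b k)
          ≡⟨ cong (g v +_) (sym (G.*-homo c (b k))) ⟩
        g v + g (λ x → c * b k x)
          ≡⟨ sym (G.+-homo _ _) ⟩
        g w
          ≡⟨ p (+-closed Pv (*-closed c (IsBasis.inside B k)) , f₀w≡0) ⟩
        0ℚ ∎
        where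
        c = - (f zero v * r)
        w : ℚ^ I
        w x = v x + c * b k x
        f₀w≡0 : f zero w ≡ 0ℚ
        f₀w≡0 = eliminated {u = b k} (F zero) (proj₂ (reciprocal q≢0)) v

  -- An injective linear map carries a basis of `P` to a basis of its image. Here `into` and `onto`
  -- identify `Q` with that image up to `≗`.
  image-dimension : ∀ {J : Set} {P : Pred (ℚ^ I) 0ℓ} {Q : Pred (ℚ^ J) 0ℓ} (F : ℚ^ I → ℚ^ J) →
    (∀ y → IsLinear (λ v → F v y)) → IsSubspace P →
    (∀ {v} → P v → F v ≗ const 0ℚ → v ≗ const 0ℚ) →
    (∀ {v} → P v → Q (F v)) →
    (∀ {w} → Q w → ∃[ v ] (P v × F v ≗ w)) →
    ∀ {d} → HasDimension P d → HasDimension Q d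
  image-dimension {P = P} F F-linear P-sub injective into onto (b , B) = F ∘ b , record
    { inside      = into ∘ inside
    ; independent = λ a p → independent a (injective (combination-closed a b inside)
        (λ y → trans (IsLinear.combination-homo (F-linear y) a b) (p y)))
    ; spanning    = λ Qw → let v , Pv , Fv≗w = onto Qw
                               a , p = spanning Pv
        in a , λ y → begin
             linearCombination a (F ∘ b) y  ≡⟨ sym (IsLinear.combination-homo (F-linear y) a b) ⟩
             F (linearCombination a b) y    ≡⟨ IsLinear.preserves-≗ (F-linear y) p ⟩
             F v y                          ≡⟨ Fv≗w y ⟩
             _                              ∎
    }
    where
    open IsBasis B
    open IsSubspace P-sub
    combination-closed : ∀ {d} a (b : Fin d → ℚ^ I) → (∀ k → P (b k)) → P (linearCombination a b)
    combination-closed {zero}  a b p = 0-closed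
    combination-closed {suc d} a b p =
      +-closed (*-closed (a zero) (p zero)) (combination-closed (a ∘ suc) (b ∘ suc) (p ∘ suc))

-- Full coordinate spaces, common kernels and images

everything : ∀ {I : Set} → Pred (ℚ^ I) 0ℓ
everything _ = ⊤

everything-subspace : ∀ {I : Set} → IsSubspace (everything {I})
-- Every field ends in `⊤`, so eta supplies the record.
everything-subspace = _

everything-dimension : ∀ m → HasDimension (everything {Fin m}) m
everything-dimension m = δ , record
  { inside      = _
  ; independent = λ a p x → trans (sym (combination a x)) (p x)
  ; spanning    = λ {v} _ → v , combination v
  }
  where
  combination : ∀ a x → linearCombination a δ x ≡ a x
  combination a x = trans
    (sum-cong-≗ λ k → trans (ℚ.*-comm (a k) (δ k x)) (cong (_* a k) (δ-sym k x)))
    (sum-δ x a)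
    where
    δ-sym : ∀ i k → δ {m} i k ≡ δ k i
    δ-sym i k with k ≟ i
    ... | yes refl = δ-same i
    ... | no k≢i   = δ-distinct (k≢i ∘ sym)

family-kernel-subspace : ∀ {I A : Set} {P : Pred (ℚ^ I) 0ℓ} {f : A → ℚ^ I → ℚ} →
  IsSubspace P → (∀ a → IsLinear (f a)) → IsSubspace (P ∩ λ v → ∀ a → f a v ≡ 0ℚ)
family-kernel-subspace {f = f} P-sub F = record
  { resp-≗   = λ p (Pu , fu≡0) → resp-≗ p Pu , λ a → trans (sym (preserves-≗ (F a) p)) (fu≡0 a)
  ; 0-closed = 0-closed , λ a → 0-homo (F a)
  ; +-closed = λ {u} {v} (Pu , fu≡0) (Pv , fv≡0) → +-closed Pu Pv ,
      λ a → trans (+-homo (F a) u v) (cong₂ _+_ (fu≡0 a) (fv≡0 a))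
  ; *-closed = λ q {v} (Pv , fv≡0) → *-closed q Pv ,
      λ a → trans (*-homo (F a) q v) (trans (cong (q *_) (fv≡0 a)) (ℚ.*-zeroʳ q))
  }
  where
  open IsSubspace P-sub
  open IsLinear

image-subspace : ∀ {I J : Set} {P : Pred (ℚ^ I) 0ℓ} {Q : Pred (ℚ^ J) 0ℓ} (F : ℚ^ I → ℚ^ J) →
  (∀ y → IsLinear (λ v → F v y)) → IsSubspace P →
  (∀ {v w} → P v → F v ≗ w → Q w) →
  (∀ {w} → Q w → ∃[ v ] (P v × F v ≗ w)) →
  IsSubspace Q
image-subspace F F-linear P-sub into onto = record
  { resp-≗   = λ p Qu → let v , Pv , q = onto Qu in into Pv (λ y → trans (q y) (p y))
  ; 0-closed = into 0-closed (λ y → 0-homo (F-linear y))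
  ; +-closed = λ Qu Qv → let v , Pv , q = onto Qu ; v′ , Pv′ , q′ = onto Qv in
      into (+-closed Pv Pv′) (λ y → trans (+-homo (F-linear y) v v′) (cong₂ _+_ (q y) (q′ y)))
  ; *-closed = λ a Qv → let v , Pv , q = onto Qv in
      into (*-closed a Pv) (λ y → trans (*-homo (F-linear y) a v) (cong (a *_) (q y)))
  }
  where
  open IsSubspace P-sub
  open IsLinear

-- The symmetric form on the orthogonal space

⟪⟫-cong : ∀ {n} {u u′ v v′ : ℚ^ E⊎E* n} → u ≗ u′ → v ≗ v′ → ⟪ u , v ⟫ ≡ ⟪ u′ , v′ ⟫
⟪⟫-cong p q = sum-cong-≗ λ e →
  cong₂ _+_ (cong₂ _*_ (p (inj₁ e)) (q (inj₂ e))) (cong₂ _*_ (p (inj₂ e)) (q (inj₁ e)))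

-- In `⟪ u , v ⟫ - ⟪ u , u ⟫` all terms cancel except the one at `j`.
isotropic-at-edge : ∀ {n} (j : Fin n) (u v : ℚ^ E⊎E* n) → ⟪ u , u ⟫ ≡ 0ℚ → ⟪ u , v ⟫ ≡ 0ℚ →
  (∀ e → e ≢ j → u (inj₁ e) ≡ v (inj₁ e) × u (inj₂ e) ≡ v (inj₂ e)) →
  u (inj₁ j) * v (inj₂ j) + u (inj₂ j) * v (inj₁ j) ≡ u (inj₁ j) * u (inj₂ j) + u (inj₂ j) * u (inj₁ j)
isotropic-at-edge j u v uu≡0 uv≡0 agree = x-y≡0⇒x≡y (begin
  form v j - form u j               ≡⟨ sym (sum-single j off) ⟩
  sum (λ e → form v e - form u e)   ≡⟨ sum-minus (form v) (form u) ⟩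
  ⟪ u , v ⟫ - ⟪ u , u ⟫             ≡⟨ cong₂ _-_ uv≡0 uu≡0 ⟩
  0ℚ                                ∎)
  where
  form : ℚ^ E⊎E* _ → Fin _ → ℚ
  form w e = u (inj₁ e) * w (inj₂ e) + u (inj₂ e) * w (inj₁ e)
  off : ∀ e → e ≢ j → form v e - form u e ≡ 0ℚ
  off e e≢j with p , q ← agree e e≢j =
    x≡y⇒x-y≡0 (cong₂ (λ x y → u (inj₁ e) * y + u (inj₂ e) * x) (sym p) (sym q))

-- Balanced functions on the corners of a map

module _ {n} (M : Map n) where
  open Map M

  σ⁻¹ : Label n → Label n
  σ⁻¹ d = σ ⟨$⟩ˡ d

  αᶠ : Label n → Label n
  αᶠ d = α ⟨$⟩ʳ d

  φ⁻¹≡ασ : ∀ d → φ ⟨$⟩ˡ d ≡ αᶠ (σ ⟨$⟩ʳ d)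
  φ⁻¹≡ασ d = trans (cong (φ ⟨$⟩ˡ_) (sym (σαφ≈1 d))) (inverseˡ φ)

  -- This is how connectedness is used. Invariance under `φ` follows from that under `σ` and `α` by
  -- the relation σαφ = 1, and transitivity does the rest.
  invariant⇒constant : ∀ {A : Set} (f : Label n → A) →
    (∀ d → f (σ ⟨$⟩ʳ d) ≡ f d) → (∀ d → f (αᶠ d) ≡ f d) → ∀ d d′ → f d ≡ f d′
  invariant⇒constant f f-σ f-α d d′ with π , p , refl ← transitive d d′ = sym (invariant p d)
    where
    f-φ : ∀ d → f (φ ⟨$⟩ʳ d) ≡ f d
    f-φ d = begin
      f (φ ⟨$⟩ʳ d)                       ≡⟨ sym (f-σ _) ⟩
      f (σ ⟨$⟩ʳ (φ ⟨$⟩ʳ d))              ≡⟨ sym (f-α _) ⟩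
      f (αᶠ (σ ⟨$⟩ʳ (φ ⟨$⟩ʳ d)))         ≡⟨ cong f (sym (φ⁻¹≡ασ _)) ⟩
      f (φ ⟨$⟩ˡ (φ ⟨$⟩ʳ d))              ≡⟨ cong f (inverseˡ φ) ⟩
      f d                                ∎
    invariant : ∀ {π} → ⟨ σ , α , φ ⟩∋ π → ∀ d → f (π ⟨$⟩ʳ d) ≡ f d
    invariant gen-σ d = f-σ d
    invariant gen-α d = f-α d
    invariant gen-φ d = f-φ d
    invariant unit  d = refl
    invariant (product p q) d = trans (invariant q _) (invariant p d)
    invariant (inverse {π} p) d = trans (sym (invariant p _)) (cong f (inverseʳ π))

  imbalance : Label n → ℚ^ Label n → ℚ
  imbalance d h = (h d + h (αᶠ d)) - (h (σ⁻¹ d) + h (σ⁻¹ (αᶠ d)))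

  -- The factor `everything` gives the shape of a common kernel that `family-kernel-subspace`
  -- expects.
  Balanced : Pred (ℚ^ Label n) 0ℓ
  Balanced = everything ∩ λ h → ∀ d → imbalance d h ≡ 0ℚ

  imbalance-linear : ∀ d → IsLinear (imbalance d)
  imbalance-linear d = +-linear (+-linear (eval-linear d) (eval-linear (αᶠ d)))
    (neg-linear (+-linear (eval-linear (σ⁻¹ d)) (eval-linear (σ⁻¹ (αᶠ d)))))

  imbalance-α : ∀ d h → imbalance (αᶠ d) h ≡ imbalance d h
  imbalance-α d h = trans
    (cong (λ x → (h (αᶠ d) + h x) - (h (σ⁻¹ (αᶠ d)) + h (σ⁻¹ x))) (α-involutive d))
    (solve 4 (λ a b c d → (b :+ a) :- (d :+ c) := (a :+ b) :- (c :+ d)) refl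
      (h d) (h (αᶠ d)) (h (σ⁻¹ d)) (h (σ⁻¹ (αᶠ d))))

  balanced-subspace : IsSubspace Balanced
  balanced-subspace = family-kernel-subspace everything-subspace imbalance-linear

  -- Incidence vectors of balanced functions

  module _ (o : Orientation M) where
    open Orientation o

    label-cases : ∀ d → d ≡ tail (edge d) ⊎ d ≡ αᶠ (tail (edge d))
    label-cases d = edge-fibre (tail (edge d)) d (edge-tail (edge d))

    label-elim : ∀ {P : Label n → Set} → (∀ e → P (tail e)) → (∀ e → P (αᶠ (tail e))) → ∀ d → P d
    label-elim {P} P-tail P-α d with label-cases d
    ... | inj₁ p = subst P (sym p) (P-tail (edge d))
    ... | inj₂ p = subst P (sym p) (P-α (edge d))

    edge-α-tail : ∀ e → edge (αᶠ (tail e)) ≡ e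
    edge-α-tail e = trans (edge-α (tail e)) (edge-tail e)

    -- Both sides are double sums over labels and edges. After exchanging the order, a label `d`
    -- meets only its own edge, and there exactly once because `α` has no fixed point.
    sum-over-edges : ∀ (F : Label n → ℚ) → sum (λ e → F (tail e) + F (αᶠ (tail e))) ≡ sum F
    sum-over-edges F = begin
      sum (λ e → F (tail e) + F (αᶠ (tail e)))
        ≡⟨ sum-cong-≗ (λ e → sym (cong₂ _+_ (sum-δ (tail e) F) (sum-δ (αᶠ (tail e)) F))) ⟩
      sum (λ e → sum (λ d → δ (tail e) d * F d) + sum (λ d → δ (αᶠ (tail e)) d * F d))
        ≡⟨ sum-cong-≗ (λ e → sym (∑-distrib-+ (λ d → δ (tail e) d * F d) (λ d → δ (αᶠ (tail e)) d * F d))) ⟩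
      sum (λ e → sum (λ d → term d e))
        ≡⟨ ∑-comm (λ e d → term d e) ⟩
      sum (λ d → sum (term d))
        ≡⟨ sum-cong-≗ (λ d → trans (sum-single (edge d) (off d)) (on d)) ⟩
      sum F ∎
      where
      term : Label n → Fin n → ℚ
      term d e = δ (tail e) d * F d + δ (αᶠ (tail e)) d * F d

      off : ∀ d e → e ≢ edge d → term d e ≡ 0ℚ
      off d e e≢ = begin
        term d e
          ≡⟨ cong₂ (λ x y → x * F d + y * F d)
               (δ-distinct (λ p → e≢ (trans (sym (edge-tail e)) (cong edge p))))
               (δ-distinct (λ p → e≢ (trans (sym (edge-α-tail e)) (cong edge p)))) ⟩
        0ℚ * F d + 0ℚ * F d
          ≡⟨ solve 1 (λ x → con 0ℚ :* x :+ con 0ℚ :* x := con 0ℚ) refl (F d) ⟩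
        0ℚ ∎

      on : ∀ d → term d (edge d) ≡ F d
      on d with tail (edge d) | label-cases d
      ... | t | inj₁ refl = trans
        (cong₂ (λ x y → x * F d + y * F d) (δ-same d) (δ-distinct (α-noFixedPoint d)))
        (solve 1 (λ x → con 1ℚ :* x :+ con 0ℚ :* x := x) refl (F d))
      ... | t | inj₂ refl = trans
        (cong₂ (λ x y → x * F d + y * F d) (δ-distinct (λ p → α-noFixedPoint t (sym p))) (δ-same d))
        (solve 1 (λ x → con 0ℚ :* x :+ con 1ℚ :* x := x) refl (F d))

    incidence : ℚ^ Label n → ℚ^ E⊎E* n
    incidence h (inj₁ e) = h (αᶠ (tail e)) - h (σ⁻¹ (tail e))
    incidence h (inj₂ e) = h (σ⁻¹ (tail e)) - h (tail e)

    incidence-linear : ∀ x → IsLinear (λ h → incidence h x)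
    incidence-linear (inj₁ e) = +-linear (eval-linear _) (neg-linear (eval-linear _))
    incidence-linear (inj₂ e) = +-linear (eval-linear _) (neg-linear (eval-linear _))

    incidence-of-cycle : ∀ {v} → ι[H₁] M o v → ∃[ h ] (Balanced h × incidence h ≗ v)
    incidence-of-cycle {v} ((z , ∂z≡0) , z≗v) = h , (_ , balanced) , λ x → trans (agrees x) (z≗v x)
      where
      p q h : ℚ^ Label n
      p d = z (around-vertex d)
      q d = z (around-face d)
      h d = p d - q d

      -- This is the cycle condition at the corner `σ⁻¹ d`, whose preimage under `φ` is `α d`.
      h∘σ⁻¹ : ∀ d → h (σ⁻¹ d) ≡ p d - q (αᶠ d)
      h∘σ⁻¹ d = x-y≡0⇒x≡y (trans
        (solve 4 (λ a b c d → (a :- b) :- (c :- d) := (a :- c) :+ (d :- b)) refl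
          (p (σ⁻¹ d)) (q (σ⁻¹ d)) (p d) (q (αᶠ d)))
        (subst₂ (λ s f → (p (σ⁻¹ d) - p s) + (q f - q (σ⁻¹ d)) ≡ 0ℚ) (inverseʳ σ)
          (trans (φ⁻¹≡ασ (σ⁻¹ d)) (cong αᶠ (inverseʳ σ))) (∂z≡0 (σ⁻¹ d))))

      balanced : ∀ d → imbalance d h ≡ 0ℚ
      balanced d = begin
        imbalance d h
          ≡⟨ cong₂ (λ x y → (h d + h (αᶠ d)) - (x + y)) (h∘σ⁻¹ d)
               (trans (h∘σ⁻¹ (αᶠ d)) (cong (λ x → p (αᶠ d) - q x) (α-involutive d))) ⟩
        (h d + h (αᶠ d)) - ((p d - q (αᶠ d)) + (p (αᶠ d) - q d))
          ≡⟨ solve 4 (λ a b c d → ((a :- b) :+ (c :- d)) :- ((a :- d) :+ (c :- b)) := con 0ℚ) refl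
               (p d) (q d) (p (αᶠ d)) (q (αᶠ d)) ⟩
        0ℚ ∎

      agrees : incidence h ≗ index M o z
      agrees (inj₁ e) = trans (cong (_-_ (h (αᶠ (tail e)))) (h∘σ⁻¹ (tail e)))
        (solve 3 (λ a b c → (a :- b) :- (c :- b) := a :- c) refl
          (p (αᶠ (tail e))) (q (αᶠ (tail e))) (p (tail e)))
      agrees (inj₂ e) = trans (cong (_- h (tail e)) (h∘σ⁻¹ (tail e)))
        (solve 3 (λ a b c → (a :- b) :- (a :- c) := c :- b) refl
          (p (tail e)) (q (αᶠ (tail e))) (q (tail e)))

    cycle-of-balanced : ∀ {h v} → Balanced h → incidence h ≗ v → ι[H₁] M o v
    cycle-of-balanced {h} (_ , balanced) h≗v = (z , cycle) , λ x → trans (agrees x) (h≗v x)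
      where
      y : ℚ^ Label n
      y d = h (σ⁻¹ d) - h d

      -- A restatement of balance at `d`. Being odd under `α`, `y` is the difference of the values
      -- of `½ * y` at `d` and `α d`.
      y-α : ∀ d → y (αᶠ d) ≡ - y d
      y-α d = x-y≡0⇒x≡y (trans
        (solve 4 (λ a b c d → (d :- b) :- (:- (c :- a)) := :- ((a :+ b) :- (c :+ d))) refl
          (h d) (h (αᶠ d)) (h (σ⁻¹ d)) (h (σ⁻¹ (αᶠ d))))
        (cong -_ (balanced d)))

      -- The face values only have to satisfy q d − q (α d) = y d.
      z : ℚ^ Cell₁ M
      z (around-vertex d) = h d + ½ * y d
      z (around-face d)   = ½ * y d

      cycle : ∂₁ M z ≗ const 0ℚ
      cycle d = begin
        (h d + ½ * y d - (h (σ ⟨$⟩ʳ d) + ½ * y (σ ⟨$⟩ʳ d))) + (½ * y (φ ⟨$⟩ˡ d) - ½ * y d)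
          ≡⟨ cong₂ (λ a b → (h d + ½ * y d - (h (σ ⟨$⟩ʳ d) + ½ * a)) + (½ * b - ½ * y d))
               yσ (trans (cong y (φ⁻¹≡ασ d)) (trans (y-α _) (cong -_ yσ))) ⟩
        (h d + ½ * y d - (h (σ ⟨$⟩ʳ d) + ½ * (h d - h (σ ⟨$⟩ʳ d))))
          + (½ * (- (h d - h (σ ⟨$⟩ʳ d))) - ½ * y d)
          ≡⟨ solve 3 (λ a b c → ((a :+ con ½ :* c) :- (b :+ con ½ :* (a :- b)))
                                :+ (con ½ :* (:- (a :- b)) :- con ½ :* c) := con 0ℚ) refl
               (h d) (h (σ ⟨$⟩ʳ d)) (y d) ⟩
        0ℚ ∎
        where
        yσ : y (σ ⟨$⟩ʳ d) ≡ h d - h (σ ⟨$⟩ʳ d)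
        yσ = cong (λ x → h x - h (σ ⟨$⟩ʳ d)) (inverseˡ σ)

      agrees : index M o z ≗ incidence h
      agrees (inj₁ e) = trans
        (cong (λ x → h (αᶠ (tail e)) + ½ * x - (h (tail e) + ½ * y (tail e))) (y-α (tail e)))
        (solve 3 (λ a b c → (a :+ con ½ :* (:- (b :- c))) :- (c :+ con ½ :* (b :- c)) := a :- b) refl
          (h (αᶠ (tail e))) (h (σ⁻¹ (tail e))) (h (tail e)))
      agrees (inj₂ e) = trans
        (cong (λ x → ½ * y (tail e) - ½ * x) (y-α (tail e)))
        (solve 1 (λ x → con ½ :* x :- con ½ :* (:- x) := x) refl (y (tail e)))

    incidence-isotropic : ∀ {h h′} → Balanced h → Balanced h′ → ⟪ incidence h , incidence h′ ⟫ ≡ 0ℚ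
    incidence-isotropic {h} {h′} (_ , B) (_ , B′) = begin
      ⟪ incidence h , incidence h′ ⟫
        ≡⟨ sum-cong-≗ (λ e → local (tail e)) ⟩
      sum (λ e → G (tail e) + G (αᶠ (tail e)))
        ≡⟨ sum-over-edges G ⟩
      sum G
        ≡⟨ sum-telescope σ (λ d → h d * h′ d) ⟩
      0ℚ ∎
      where
      G : Label n → ℚ
      G d = h d * h′ d - h (σ⁻¹ d) * h′ (σ⁻¹ d)

      local : ∀ d → (h (αᶠ d) - h (σ⁻¹ d)) * (h′ (σ⁻¹ d) - h′ d) + (h (σ⁻¹ d) - h d) * (h′ (αᶠ d) - h′ (σ⁻¹ d))
                    ≡ G d + G (αᶠ d)
      -- The cofactors of the imbalances come from eliminating h (σ⁻¹ (αᶠ d)).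
      local d = x-y≡0⇒x≡y (begin
        (h (αᶠ d) - h (σ⁻¹ d)) * (h′ (σ⁻¹ d) - h′ d) + (h (σ⁻¹ d) - h d) * (h′ (αᶠ d) - h′ (σ⁻¹ d))
          - (G d + G (αᶠ d))
          ≡⟨ solve 8 (λ a b c d a′ b′ c′ d′ →
               (b :- c) :* (c′ :- a′) :+ (c :- a) :* (b′ :- c′)
                 :- ((a :* a′ :- c :* c′) :+ (b :* b′ :- d :* d′))
               := :- (((a :+ b) :- (c :+ d)) :* (a′ :+ b′ :- c′)) :- ((a′ :+ b′) :- (c′ :+ d′)) :* d) refl
               (h d) (h (αᶠ d)) (h (σ⁻¹ d)) (h (σ⁻¹ (αᶠ d)))
               (h′ d) (h′ (αᶠ d)) (h′ (σ⁻¹ d)) (h′ (σ⁻¹ (αᶠ d))) ⟩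
        - (imbalance d h * (h′ d + h′ (αᶠ d) - h′ (σ⁻¹ d))) - imbalance d h′ * h (σ⁻¹ (αᶠ d))
          ≡⟨ cong₂ (λ x y → - (x * (h′ d + h′ (αᶠ d) - h′ (σ⁻¹ d))) - y * h (σ⁻¹ (αᶠ d))) (B d) (B′ d) ⟩
        - (0ℚ * (h′ d + h′ (αᶠ d) - h′ (σ⁻¹ d))) - 0ℚ * h (σ⁻¹ (αᶠ d))
          ≡⟨ solve 2 (λ x y → :- (con 0ℚ :* x) :- con 0ℚ :* y := con 0ℚ) refl
               (h′ d + h′ (αᶠ d) - h′ (σ⁻¹ d)) (h (σ⁻¹ (αᶠ d))) ⟩
        0ℚ ∎)

-- Dimensions

module _ {n} (M : Map n) (o : Orientation M) (j : Fin n) where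
  open Map M
  open Orientation o

  -- The imbalances sum to 0, and incidence vectors do not see constants.
  -- The extra term makes the n constraints independent, and at the same
  -- time normalises h to vanish at one label.
  constraint : Fin n → ℚ^ Label n → ℚ
  constraint e h = imbalance M (tail e) h + δ j e * h (tail j)

  constraint-linear : ∀ e → IsLinear (constraint e)
  constraint-linear e = +-linear (imbalance-linear M (tail e)) (scale-linear (δ j e) (eval-linear (tail j)))

  -- Regrouping by labels turns a combination of imbalances into a pairing of `t ∘ edge` with the
  -- differences of `h` along `σ`.
  weighted-imbalance : ∀ (t : Fin n → ℚ) h →
    sum (λ e → t e * imbalance M (tail e) h) ≡ sum (λ d → t (edge d) * (h d - h (σ⁻¹ M d)))
  weighted-imbalance t h = trans (sum-cong-≗ λ e → trans
    (solve 5 (λ t a b c d → t :* ((a :+ b) :- (c :+ d)) := t :* (a :- c) :+ t :* (b :- d)) refl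
      (t e) (h (tail e)) (h (αᶠ M (tail e))) (h (σ⁻¹ M (tail e))) (h (σ⁻¹ M (αᶠ M (tail e)))))
    (cong₂ (λ x y → t x * (h (tail e) - h (σ⁻¹ M (tail e)))
                  + t y * (h (αᶠ M (tail e)) - h (σ⁻¹ M (αᶠ M (tail e)))))
      (sym (edge-tail e)) (sym (edge-α-tail M o e))))
    (sum-over-edges M o (λ d → t (edge d) * (h d - h (σ⁻¹ M d))))

  weighted-constraint : ∀ (t : Fin n → ℚ) h → sum (λ e → t e * constraint e h)
    ≡ sum (λ d → t (edge d) * (h d - h (σ⁻¹ M d))) + t j * h (tail j)
  weighted-constraint t h = begin
    sum (λ e → t e * constraint e h)
      ≡⟨ sum-cong-≗ (λ e → solve 4 (λ t x y z → t :* (x :+ y :* z) := t :* x :+ y :* (t :* z)) refl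
           (t e) (imbalance M (tail e) h) (δ j e) (h (tail j))) ⟩
    sum (λ e → t e * imbalance M (tail e) h + δ j e * (t e * h (tail j)))
      ≡⟨ ∑-distrib-+ (λ e → t e * imbalance M (tail e) h) (λ e → δ j e * (t e * h (tail j))) ⟩
    sum (λ e → t e * imbalance M (tail e) h) + sum (λ e → δ j e * (t e * h (tail j)))
      ≡⟨ cong₂ _+_ (weighted-imbalance t h) (sum-δ j (λ e → t e * h (tail j))) ⟩
    sum (λ d → t (edge d) * (h d - h (σ⁻¹ M d))) + t j * h (tail j) ∎

  -- These turn out to be the balanced functions vanishing at `tail j`, presented as the common
  -- kernel of exactly `n` functionals.
  Normalised : Pred (ℚ^ Label n) 0ℓ
  Normalised = everything ∩ λ h → ∀ e → constraint e h ≡ 0ℚ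

  -- When all constraints are added, the imbalances telescope and only the extra term of the edge
  -- `j` survives.
  normalised⇒vanishing : ∀ h → Normalised h → h (tail j) ≡ 0ℚ
  normalised⇒vanishing h (_ , C) = begin
    h (tail j)
      ≡⟨ solve 1 (λ x → x := con 0ℚ :+ con 1ℚ :* x) refl (h (tail j)) ⟩
    0ℚ + 1ℚ * h (tail j)
      ≡⟨ cong (_+ 1ℚ * h (tail j)) (sym (trans
           (sum-cong-≗ (λ d → ℚ.*-identityˡ (h d - h (σ⁻¹ M d)))) (sum-telescope σ h))) ⟩
    sum (λ d → 1ℚ * (h d - h (σ⁻¹ M d))) + 1ℚ * h (tail j)
      ≡⟨ sym (weighted-constraint (const 1ℚ) h) ⟩
    sum (λ e → 1ℚ * constraint e h)
      ≡⟨ sum-zero (λ e → trans (ℚ.*-identityˡ (constraint e h)) (C e)) ⟩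
    0ℚ ∎

  constraint≡imbalance : ∀ h → h (tail j) ≡ 0ℚ → ∀ e → constraint e h ≡ imbalance M (tail e) h
  constraint≡imbalance h p e = trans (cong (λ x → imbalance M (tail e) h + δ j e * x) p)
    (solve 2 (λ x y → x :+ y :* con 0ℚ := x) refl (imbalance M (tail e) h) (δ j e))

  normalised⇒balanced : ∀ {h} → Normalised h → Balanced M h
  normalised⇒balanced {h} N@(_ , C) = _ ,
    label-elim M o balanced (λ e → trans (imbalance-α M (tail e) h) (balanced e))
    where
    balanced : ∀ e → imbalance M (tail e) h ≡ 0ℚ
    balanced e = trans (sym (constraint≡imbalance h (normalised⇒vanishing h N) e)) (C e)

  normalise : ℚ^ Label n → ℚ^ Label n
  normalise h d = h d - h (tail j)

  normalise-normalised : ∀ {h} → Balanced M h → Normalised (normalise h)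
  normalise-normalised {h} (_ , B) = _ , λ e → begin
    constraint e (normalise h)
      ≡⟨ constraint≡imbalance (normalise h) (ℚ.+-inverseʳ (h (tail j))) e ⟩
    imbalance M (tail e) (normalise h)
      ≡⟨ solve 5 (λ a b c d x → ((a :- x) :+ (b :- x)) :- ((c :- x) :+ (d :- x)) := (a :+ b) :- (c :+ d)) refl
           (h (tail e)) (h (αᶠ M (tail e))) (h (σ⁻¹ M (tail e))) (h (σ⁻¹ M (αᶠ M (tail e)))) (h (tail j)) ⟩
    imbalance M (tail e) h
      ≡⟨ B (tail e) ⟩
    0ℚ ∎

  cancel : ∀ a b x → (a - x) - (b - x) ≡ a - b
  cancel = solve 3 (λ a b x → (a :- x) :- (b :- x) := a :- b) refl

  incidence-normalise : ∀ h → incidence M o (normalise h) ≗ incidence M o h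
  incidence-normalise h (inj₁ e) = cancel (h (αᶠ M (tail e))) (h (σ⁻¹ M (tail e))) (h (tail j))
  incidence-normalise h (inj₂ e) = cancel (h (σ⁻¹ M (tail e))) (h (tail e)) (h (tail j))

  -- Zero coordinates at an edge equate three of the four values of `h` in its balance condition,
  -- which then gives the fourth. So `h` is invariant under `σ` and `α`, hence constant, and it
  -- vanishes at `tail j`.
  incidence-injective : ∀ {h} → Normalised h → incidence M o h ≗ const 0ℚ → h ≗ const 0ℚ
  incidence-injective {h} N p d =
    trans (invariant⇒constant M h h-σ h-α d (tail j)) (normalised⇒vanishing h N)
    where
    balanced = proj₂ (normalised⇒balanced {h} N)

    at-tail : ∀ e → let t = tail e in h (σ⁻¹ M t) ≡ h t × h (αᶠ M t) ≡ h t × h (σ⁻¹ M (αᶠ M t)) ≡ h t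
    at-tail e = c≡a , b≡a , d≡a
      where
      t = tail e
      c≡a : h (σ⁻¹ M t) ≡ h t
      c≡a = x-y≡0⇒x≡y (p (inj₂ e))
      b≡a : h (αᶠ M t) ≡ h t
      b≡a = trans (x-y≡0⇒x≡y (p (inj₁ e))) c≡a
      d≡a : h (σ⁻¹ M (αᶠ M t)) ≡ h t
      d≡a = sym (x-y≡0⇒x≡y (begin
        h t - h (σ⁻¹ M (αᶠ M t))
          ≡⟨ solve 2 (λ x y → x :- y := (x :+ x) :- (x :+ y)) refl (h t) (h (σ⁻¹ M (αᶠ M t))) ⟩
        (h t + h t) - (h t + h (σ⁻¹ M (αᶠ M t)))
          ≡⟨ sym (cong₂ (λ b c → (h t + b) - (c + h (σ⁻¹ M (αᶠ M t)))) b≡a c≡a) ⟩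
        imbalance M t h
          ≡⟨ balanced t ⟩
        0ℚ ∎))

    h-σ⁻¹ : ∀ d → h (σ⁻¹ M d) ≡ h d
    h-σ⁻¹ = label-elim M o
      (λ e → let c≡a , b≡a , d≡a = at-tail e in c≡a)
      (λ e → let c≡a , b≡a , d≡a = at-tail e in trans d≡a (sym b≡a))

    h-σ : ∀ d → h (σ ⟨$⟩ʳ d) ≡ h d
    h-σ d = trans (sym (h-σ⁻¹ _)) (cong h (inverseˡ σ))

    h-α : ∀ d → h (αᶠ M d) ≡ h d
    h-α = label-elim M o
      (λ e → let c≡a , b≡a , d≡a = at-tail e in b≡a)
      (λ e → let c≡a , b≡a , d≡a = at-tail e in trans (cong h (α-involutive _)) (sym b≡a))

  -- For T = t ∘ edge, testing the relation on T or on T ∘ σ, whichever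
  -- takes equal values at u and u′, gives Σ (T − T ∘ σ⁻¹)² = 0.
  constraints-independent : ∀ {u u′} → edge u ≡ edge u′ ⊎ edge (σ ⟨$⟩ʳ u) ≡ edge (σ ⟨$⟩ʳ u′) →
    ∀ (s : ℚ) (t : Fin n → ℚ) →
    (∀ h → s * (h u - h u′) + sum (λ e → t e * constraint e h) ≡ 0ℚ) → ∀ e → t e ≡ 0ℚ
  constraints-independent {u} {u′} u~u′ s t relation e = begin
    t e                ≡⟨ cong t (sym (edge-tail e)) ⟩
    T (tail e)         ≡⟨ invariant⇒constant M T T-σ (cong t ∘ edge-α) (tail e) (tail j) ⟩
    T (tail j)         ≡⟨ cong t (edge-tail j) ⟩
    t j                ≡⟨ t-j ⟩
    0ℚ                 ∎
    where
    T : ℚ^ Label n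
    T d = t (edge d)

    pairing : ℚ^ Label n → ℚ
    pairing h = sum (λ d → T d * (h d - h (σ⁻¹ M d)))

    relation′ : ∀ h → h u ≡ h u′ → pairing h + t j * h (tail j) ≡ 0ℚ
    relation′ h p = begin
      pairing h + t j * h (tail j)
        ≡⟨ sym (weighted-constraint t h) ⟩
      sum (λ e → t e * constraint e h)
        ≡⟨ solve 2 (λ s x → x := s :* con 0ℚ :+ x) refl s (sum (λ e → t e * constraint e h)) ⟩
      s * 0ℚ + sum (λ e → t e * constraint e h)
        ≡⟨ cong (λ x → s * x + sum (λ e → t e * constraint e h)) (sym (x≡y⇒x-y≡0 p)) ⟩
      s * (h u - h u′) + sum (λ e → t e * constraint e h)
        ≡⟨ relation h ⟩
      0ℚ ∎

    -- The relation is tested on the constant 1, whose pairing is 0.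
    t-j : t j ≡ 0ℚ
    t-j = begin
      t j                           ≡⟨ solve 1 (λ x → x := con 0ℚ :+ x :* con 1ℚ) refl (t j) ⟩
      0ℚ + t j * 1ℚ                 ≡⟨ cong (_+ t j * 1ℚ) (sym (sum-zero (λ d → ℚ.*-zeroʳ (T d)))) ⟩
      pairing (const 1ℚ) + t j * 1ℚ ≡⟨ relation′ (const 1ℚ) refl ⟩
      0ℚ                            ∎

    pairing≡0 : ∀ h → h u ≡ h u′ → pairing h ≡ 0ℚ
    pairing≡0 h p = begin
      pairing h                     ≡⟨ solve 2 (λ x y → x := x :+ con 0ℚ :* y) refl (pairing h) (h (tail j)) ⟩
      pairing h + 0ℚ * h (tail j)   ≡⟨ cong (λ x → pairing h + x * h (tail j)) (sym t-j) ⟩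
      pairing h + t j * h (tail j)  ≡⟨ relation′ h p ⟩
      0ℚ                            ∎

    squares : ℚ^ Label n
    squares d = (T d - T (σ⁻¹ M d)) * (T d - T (σ⁻¹ M d))

    differences : ℚ^ Label n
    differences d = T d * T d - T (σ⁻¹ M d) * T (σ⁻¹ M d)

    squares≡0 : edge u ≡ edge u′ ⊎ edge (σ ⟨$⟩ʳ u) ≡ edge (σ ⟨$⟩ʳ u′) → sum squares ≡ 0ℚ
    -- Here `T u` equals `T u′`, so `T` is an admissible test function. Modulo telescoping squares,
    -- the sum is twice `pairing T`.
    squares≡0 (inj₁ p) = begin
      sum squares
        ≡⟨ sum-cong-≗ (λ d → solve 2 (λ x y → (x :- y) :* (x :- y)
             := con (1ℚ + 1ℚ) :* (x :* (x :- y)) :- (x :* x :- y :* y)) refl (T d) (T (σ⁻¹ M d))) ⟩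
      sum (λ d → (1ℚ + 1ℚ) * (T d * (T d - T (σ⁻¹ M d))) - differences d)
        ≡⟨ sum-minus (λ d → (1ℚ + 1ℚ) * (T d * (T d - T (σ⁻¹ M d)))) differences ⟩
      sum (λ d → (1ℚ + 1ℚ) * (T d * (T d - T (σ⁻¹ M d)))) - sum differences
        ≡⟨ cong₂ _-_ (trans (sym (*-distribˡ-sum (1ℚ + 1ℚ) (λ d → T d * (T d - T (σ⁻¹ M d)))))
                       (cong ((1ℚ + 1ℚ) *_) (pairing≡0 T (cong t p))))
                     (sum-telescope σ (λ d → T d * T d)) ⟩
      0ℚ ∎
    squares≡0 (inj₂ p) = begin
      sum squares
        ≡⟨ sum-cong-≗ (λ d → solve 2 (λ x y → (x :- y) :* (x :- y)
             := (x :* x :- y :* y) :- con (1ℚ + 1ℚ) :* (y :* (x :- y))) refl (T d) (T (σ⁻¹ M d))) ⟩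
      sum (λ d → differences d - (1ℚ + 1ℚ) * (T (σ⁻¹ M d) * (T d - T (σ⁻¹ M d))))
        ≡⟨ sum-minus differences (λ d → (1ℚ + 1ℚ) * (T (σ⁻¹ M d) * (T d - T (σ⁻¹ M d)))) ⟩
      sum differences - sum (λ d → (1ℚ + 1ℚ) * (T (σ⁻¹ M d) * (T d - T (σ⁻¹ M d))))
        ≡⟨ cong₂ _-_ (sum-telescope σ (λ d → T d * T d))
             (trans (sym (*-distribˡ-sum (1ℚ + 1ℚ) (λ d → T (σ⁻¹ M d) * (T d - T (σ⁻¹ M d)))))
               (cong ((1ℚ + 1ℚ) *_) shifted)) ⟩
      0ℚ ∎
      where
      -- Reindexing by `σ⁻¹` identifies this sum with the pairing of `T ∘ σ`, the admissible test
      -- function in this case.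
      shifted : sum (λ d → T (σ⁻¹ M d) * (T d - T (σ⁻¹ M d))) ≡ 0ℚ
      shifted = begin
        sum (λ d → T (σ⁻¹ M d) * (T d - T (σ⁻¹ M d)))
          ≡⟨ sum-cong-≗ (λ d → cong₂ (λ x y → T (σ⁻¹ M d) * (T x - T y))
               (sym (inverseʳ σ)) (sym (inverseʳ σ))) ⟩
        sum (λ d → T (σ⁻¹ M d) * (T (σ ⟨$⟩ʳ σ⁻¹ M d) - T (σ ⟨$⟩ʳ σ⁻¹ M (σ⁻¹ M d))))
          ≡⟨ sym (sum-permute (λ d → T d * (T (σ ⟨$⟩ʳ d) - T (σ ⟨$⟩ʳ σ⁻¹ M d))) (flip σ)) ⟩
        pairing (λ d → T (σ ⟨$⟩ʳ d))
          ≡⟨ pairing≡0 (λ d → T (σ ⟨$⟩ʳ d)) (cong t p) ⟩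
        0ℚ ∎

    T-σ : ∀ d → T (σ ⟨$⟩ʳ d) ≡ T d
    T-σ d = trans (x-y≡0⇒x≡y (sum-squares≡0 (λ d → T d - T (σ⁻¹ M d)) (squares≡0 u~u′) (σ ⟨$⟩ʳ d)))
      (cong T (inverseˡ σ))

  -- Dimension of the image and of a hyperplane in it

  normalised-dimension : HasDimension Normalised n
  -- The number `2 * n` unfolds to `n + (n + 0)`, so the kernel has dimension `n + 0`.
  normalised-dimension = subst (HasDimension Normalised) (ℕ.+-identityʳ n)
    (common-kernel-dimension n everything-subspace (everything-dimension (2 ℕ.* n))
      constraint constraint-linear
      -- Taking `s = 0` and `u = u′` removes the additional functional.
      (λ t p → constraints-independent {tail j} {tail j} (inj₁ refl) 0ℚ t λ h →
        trans (solve 2 (λ x y → con 0ℚ :* x :+ y := y) refl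
                (h (tail j) - h (tail j)) (sum (λ e → t e * constraint e h)))
              (p {h} _)))

  -- All balanced functions serve for closure and isotropy. The dimension is counted on the
  -- normalised ones, where `incidence` is injective and still reaches the whole image.
  image-isLagrangian : IsLagrangian (ι[H₁] M o)
  image-isLagrangian = record
    { isSubspace = image-subspace (incidence M o) (incidence-linear M o) (balanced-subspace M)
        (cycle-of-balanced M o) (incidence-of-cycle M o)
    ; totallyIsotropic = λ u v Wu Wv →
        let h , B , p = incidence-of-cycle M o Wu ; h′ , B′ , p′ = incidence-of-cycle M o Wv
        in trans (sym (⟪⟫-cong p p′)) (incidence-isotropic M o {h} {h′} B B′)
    ; dimension = image-dimension (incidence M o) (incidence-linear M o)
        (family-kernel-subspace everything-subspace constraint-linear) incidence-injective
        (λ {h} N → cycle-of-balanced M o (normalised⇒balanced {h} N) (λ _ → refl))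
        (λ Wv → let h , B , p = incidence-of-cycle M o Wv in
          normalise h , normalise-normalised {h} B , λ x → trans (incidence-normalise h x) (p x))
        normalised-dimension
    }

  -- The equation `h u ≡ h u′` joins the `n` constraints. These `n + 1` independent functionals on a
  -- space of dimension `2 * n` leave dimension `n - 1`.
  equaliser-dimension : ∀ {Q : Pred (ℚ^ E⊎E* n) 0ℓ} {u u′} → u ≢ u′ →
    edge u ≡ edge u′ ⊎ edge (σ ⟨$⟩ʳ u) ≡ edge (σ ⟨$⟩ʳ u′) →
    (∀ {h v} → Balanced M h → h u ≡ h u′ → incidence M o h ≗ v → Q v) →
    (∀ {v} → Q v → ∃[ h ] (Balanced M h × h u ≡ h u′ × incidence M o h ≗ v)) →
    ∀ {m} → n ≡ suc m → HasDimension Q m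
  equaliser-dimension {Q} {u} {u′} u≢u′ u~u′ into onto {m} refl =
    subst (HasDimension Q) (ℕ.+-identityʳ m)
      (image-dimension (incidence M o) (incidence-linear M o)
        (family-kernel-subspace everything-subspace f-linear)
        (λ {h} (_ , p) → incidence-injective {h} (_ , p ∘ suc))
        (λ {h} (_ , p) → into (normalised⇒balanced {h} (_ , p ∘ suc)) (x-y≡0⇒x≡y (p zero)) (λ _ → refl))
        (λ Qv → let h , B , q , p = onto Qv in
          normalise h ,
          (_ , λ { zero    → trans (cancel (h u) (h u′) (h (tail j))) (x≡y⇒x-y≡0 q)
                 ; (suc e) → proj₂ (normalise-normalised {h} B) e }) ,
          λ x → trans (incidence-normalise h x) (p x))
        (common-kernel-dimension (suc (suc m)) everything-subspace
          (subst (HasDimension everything) (cong suc (ℕ.+-suc m (m ℕ.+ 0)))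
            (everything-dimension (2 ℕ.* suc m)))
          f f-linear independent))
    where
    f : Fin (suc n) → ℚ^ Label n → ℚ
    f zero    h = h u - h u′
    f (suc e) h = constraint e h

    f-linear : ∀ i → IsLinear (f i)
    f-linear zero    = +-linear (eval-linear u) (neg-linear (eval-linear u′))
    f-linear (suc e) = constraint-linear e

    independent : IndependentOn everything f
    independent t p = λ { zero → t₀ ; (suc e) → t₊ e }
      where
      t₊ : ∀ e → t (suc e) ≡ 0ℚ
      t₊ = constraints-independent u~u′ (t zero) (t ∘ suc) (λ h → p {h} _)

      -- With the other coefficients gone, the test function `δ u` isolates `t zero`, as `u` and
      -- `u′` differ.
      t₀ : t zero ≡ 0ℚ
      t₀ = begin
        t zero
          ≡⟨ solve 1 (λ x → x := x :* (con 1ℚ :- con 0ℚ) :+ con 0ℚ) refl (t zero) ⟩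
        t zero * (1ℚ - 0ℚ) + 0ℚ
          ≡⟨ sym (cong₂ (λ x y → t zero * x + y) (cong₂ _-_ (δ-same u) (δ-distinct u≢u′))
               (sum-zero (λ e → trans (cong (_* constraint e (δ u)) (t₊ e))
                                      (ℚ.*-zeroˡ (constraint e (δ u)))))) ⟩
        t zero * (δ u u - δ u u′) + sum (λ e → t (suc e) * constraint e (δ u))
          ≡⟨ p {δ u} _ ⟩
        0ℚ ∎

-- The partial dual

module _ {n} (M : Map n) (j : Fin n) where
  open Map M

  private
    M′ : Map n
    M′ = partialDual M j

  c-on : ∀ {d} → edge d ≡ j → c j ⟨$⟩ˡ d ≡ αᶠ M d
  c-on {d} p with edge d ≟ j
  ... | yes _ = refl
  ... | no ¬p = contradiction p ¬p

  c-off : ∀ {d} → edge d ≢ j → c j ⟨$⟩ˡ d ≡ d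
  c-off {d} ¬p with edge d ≟ j
  ... | yes p = contradiction p ¬p
  ... | no _  = refl

  -- At the edge `j` the change of `σ` only exchanges the two subtracted terms; at any other edge
  -- `c j` acts trivially.
  imbalance-dual : ∀ d h → imbalance M′ d h ≡ imbalance M d h
  imbalance-dual d h = by-cases (edge d ≟ j)
    where
    by-cases : Dec (edge d ≡ j) → imbalance M′ d h ≡ imbalance M d h
    by-cases (yes p) = begin
      (h d + h (αᶠ M d)) - (h (σ⁻¹ M (c j ⟨$⟩ˡ d)) + h (σ⁻¹ M (c j ⟨$⟩ˡ αᶠ M d)))
        ≡⟨ cong₂ (λ x y → (h d + h (αᶠ M d)) - (h (σ⁻¹ M x) + h (σ⁻¹ M y)))
             (c-on p) (trans (c-on (trans (edge-α d) p)) (α-involutive d)) ⟩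
      (h d + h (αᶠ M d)) - (h (σ⁻¹ M (αᶠ M d)) + h (σ⁻¹ M d))
        ≡⟨ cong (_-_ (h d + h (αᶠ M d))) (ℚ.+-comm (h (σ⁻¹ M (αᶠ M d))) (h (σ⁻¹ M d))) ⟩
      imbalance M d h ∎
    by-cases (no ¬p) = cong₂ (λ x y → (h d + h (αᶠ M d)) - (h (σ⁻¹ M x) + h (σ⁻¹ M y)))
      (c-off ¬p) (c-off (λ p → ¬p (trans (sym (edge-α d)) p)))

  balanced⇒dual-balanced : ∀ {h} → Balanced M h → Balanced M′ h
  balanced⇒dual-balanced {h} (_ , B) = _ , λ d → trans (imbalance-dual d h) (B d)

  dual-balanced⇒balanced : ∀ {h} → Balanced M′ h → Balanced M h
  dual-balanced⇒balanced {h} (_ , B) = _ , λ d → trans (sym (imbalance-dual d h)) (B d)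

  -- Incidence vectors of the map and of its partial dual

  module _ (o : Orientation M) (o′ : Orientation M′) (agree : AgreeAwayFrom j o o′) where
    open Orientation o
    open Orientation o′ using () renaming (tail to tail′; edge-tail to edge-tail′)

    x y x′ y′ : ℚ^ Label n → ℚ
    x h = incidence M o h (inj₁ j)
    y h = incidence M o h (inj₂ j)
    x′ h = incidence M′ o′ h (inj₁ j)
    y′ h = incidence M′ o′ h (inj₂ j)

    incidence-away : ∀ h e → e ≢ j →
      incidence M′ o′ h (inj₁ e) ≡ incidence M o h (inj₁ e) ×
      incidence M′ o′ h (inj₂ e) ≡ incidence M o h (inj₂ e)
    incidence-away h e e≢j =
      cong₂ (λ t s → h (αᶠ M t) - h (σ⁻¹ M s)) (agree e e≢j) c-tail ,
      cong₂ (λ t s → h (σ⁻¹ M s) - h t) (agree e e≢j) c-tail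
      where
      c-tail : c j ⟨$⟩ˡ tail′ e ≡ tail e
      c-tail = trans (c-off (λ p → e≢j (trans (sym (edge-tail′ e)) p))) (agree e e≢j)

    away⇒incidence : ∀ h → x′ h ≡ x h → y′ h ≡ y h → incidence M′ o′ h ≗ incidence M o h
    away⇒incidence h p q (inj₁ e) with e ≟ j
    ... | yes refl = p
    ... | no e≢j   = proj₁ (incidence-away h e e≢j)
    away⇒incidence h p q (inj₂ e) with e ≟ j
    ... | yes refl = q
    ... | no e≢j   = proj₂ (incidence-away h e e≢j)

    -- The preimages `h` and `h′` of a common vector need not coincide. Still, `incidence M o h′`
    -- differs from that vector only at `j`, so isotropy of the image of `M` yields an equation
    -- there.
    isotropy-at-j : ∀ {h h′} → Balanced M h → Balanced M h′ → incidence M o h ≗ incidence M′ o′ h′ →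
      x h * y h′ + y h * x h′ ≡ x h * y h + y h * x h
    isotropy-at-j {h} {h′} B B′ p = isotropic-at-edge j (incidence M o h) (incidence M o h′)
      (incidence-isotropic M o {h} {h} B B) (incidence-isotropic M o {h} {h′} B B′)
      (λ e e≢j → let q , r = incidence-away h′ e e≢j in trans (p (inj₁ e)) q , trans (p (inj₂ e)) r)

    private
      t : Label n
      t = tail j

    -- In the dual the inverse vertex rotation takes `t` to `σ⁻¹ (α t)`, and balance at `t` rewrites
    -- the differences involving that corner.
    same-tail : tail′ j ≡ t → ∀ h → Balanced M h → x′ h ≡ y h × y′ h ≡ x h
    same-tail p h (_ , B) =
      trans (cong₂ (λ a b → h (αᶠ M a) - h (σ⁻¹ M b)) p c-tail)
        (x-y≡0⇒x≡y (trans (solve 4 (λ a b c d → (b :- d) :- (c :- a) := (a :+ b) :- (c :+ d)) refl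
          (h t) (h (αᶠ M t)) (h (σ⁻¹ M t)) (h (σ⁻¹ M (αᶠ M t)))) (B t))) ,
      trans (cong₂ (λ a b → h (σ⁻¹ M b) - h a) p c-tail)
        (x-y≡0⇒x≡y (trans (solve 4 (λ a b c d → (d :- a) :- (b :- c) := :- ((a :+ b) :- (c :+ d))) refl
          (h t) (h (αᶠ M t)) (h (σ⁻¹ M t)) (h (σ⁻¹ M (αᶠ M t)))) (cong -_ (B t))))
      where
      c-tail : c j ⟨$⟩ˡ tail′ j ≡ αᶠ M t
      c-tail = trans (c-on (edge-tail′ j)) (cong (αᶠ M) p)

    -- In the dual the inverse vertex rotation takes `α t` to `σ⁻¹ t`, so the same three corners
    -- occur with the ends of the edge exchanged.
    opposite-tail : tail′ j ≡ αᶠ M t → ∀ h → x′ h ≡ - y h × y′ h ≡ - x h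
    opposite-tail p h =
      trans (cong₂ (λ a b → h a - h (σ⁻¹ M b)) αtail′≡t c-tail)
        (solve 2 (λ a c → a :- c := :- (c :- a)) refl (h t) (h (σ⁻¹ M t))) ,
      trans (cong₂ (λ a b → h (σ⁻¹ M b) - h a) p c-tail)
        (solve 2 (λ b c → c :- b := :- (b :- c)) refl (h (αᶠ M t)) (h (σ⁻¹ M t)))
      where
      αtail′≡t : αᶠ M (tail′ j) ≡ t
      αtail′≡t = trans (cong (αᶠ M) p) (α-involutive t)
      c-tail : c j ⟨$⟩ˡ tail′ j ≡ t
      c-tail = trans (c-on (edge-tail′ j)) αtail′≡t

    -- The intersection of the two images

    W∩W′ : Pred (ℚ^ E⊎E* n) 0ℓ
    W∩W′ = ι[H₁] M o ∩ ι[H₁] M′ o′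

    -- One and the same `h` serves as preimage for both maps.
    intersection-into : ∀ {h v} → Balanced M h → x′ h ≡ x h → y′ h ≡ y h → incidence M o h ≗ v → W∩W′ v
    intersection-into {h} B p q r =
      cycle-of-balanced M o {h} B r ,
      cycle-of-balanced M′ o′ {h} (balanced⇒dual-balanced {h} B) (λ a → trans (away⇒incidence h p q a) (r a))

    intersection-onto : ∀ {v} → W∩W′ v → ∃[ h ] ∃[ h′ ]
      (Balanced M h × Balanced M h′ × incidence M o h ≗ incidence M′ o′ h′ × incidence M o h ≗ v)
    intersection-onto (Wv , W′v) =
      let h , B , p = incidence-of-cycle M o Wv
          h′ , B′ , p′ = incidence-of-cycle M′ o′ W′v
      in h , h′ , B , dual-balanced⇒balanced {h′} B′ , (λ a → trans (p a) (sym (p′ a))) , p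

    intersection-dimension : ∀ {m} → n ≡ suc m → HasDimension W∩W′ m
    intersection-dimension with edge-fibre t (tail′ j) (trans (edge-tail j) (sym (edge-tail′ j)))
    -- With equal tails the intersection is given by `x h ≡ y h`. By balance this says that `h`
    -- agrees at `σ⁻¹ (α t)` and `σ⁻¹ t`, which `σ` sends to labels of the same edge.
    ... | inj₁ p = equaliser-dimension M o j {u = σ⁻¹ M (αᶠ M t)} {u′ = σ⁻¹ M t}
      (λ q → α-noFixedPoint t (trans (sym (inverseʳ σ)) (trans (cong (σ ⟨$⟩ʳ_) q) (inverseʳ σ))))
      (inj₂ (trans (cong edge (inverseʳ σ)) (trans (edge-α t) (sym (cong edge (inverseʳ σ))))))
      (λ {h} B q → let x′≡y , y′≡x = same-tail p h B
                       x≡y = x-y≡0⇒x≡y (trans (sym (gap h B)) (x≡y⇒x-y≡0 q))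
        in intersection-into {h} B (trans x′≡y (sym x≡y)) (trans y′≡x x≡y))
      (λ Wv → let h , h′ , B , B′ , q , r = intersection-onto Wv
                  x′≡y , y′≡x = same-tail p h′ B′
                  -- Here `y h′` equals `x h` and `x h′` equals `y h`, so `s` becomes x² + y² = 2xy.
                  s = isotropy-at-j {h} {h′} B B′ q
        in h , B , x-y≡0⇒x≡y (trans (gap h B) (x*x≡0⇒x≡0 (square (x h) (y h)
             (subst₂ (λ a b → x h * a + y h * b ≡ x h * y h + y h * x h)
               (trans (sym x′≡y) (sym (q (inj₁ j)))) (trans (sym y′≡x) (sym (q (inj₂ j)))) s)))) , r)
      where
      gap : ∀ h → Balanced M h → h (σ⁻¹ M (αᶠ M t)) - h (σ⁻¹ M t) ≡ x h - y h
      gap h (_ , B) = x-y≡0⇒x≡y (trans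
        (solve 4 (λ a b c d → (d :- c) :- ((b :- c) :- (c :- a)) := :- ((a :+ b) :- (c :+ d))) refl
          (h t) (h (αᶠ M t)) (h (σ⁻¹ M t)) (h (σ⁻¹ M (αᶠ M t))))
        (cong -_ (B t)))
      square : ∀ a b → a * a + b * b ≡ a * b + b * a → (a - b) * (a - b) ≡ 0ℚ
      square a b s = trans
        (solve 2 (λ a b → (a :- b) :* (a :- b) := (a :* a :+ b :* b) :- (a :* b :+ b :* a)) refl a b)
        (x≡y⇒x-y≡0 s)
    -- With opposite tails the condition is `x h + y h ≡ 0ℚ`, that is, equal values of `h` at the
    -- two labels of `j`.
    ... | inj₂ p = equaliser-dimension M o j {u = αᶠ M t} {u′ = t}
      (α-noFixedPoint t)
      (inj₁ (edge-α t))
      (λ {h} B q → let x′≡-y , y′≡-x = opposite-tail p h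
                       x+y≡0 = trans (sym (gap h)) (x≡y⇒x-y≡0 q)
        in intersection-into {h} B
             (trans x′≡-y (sym (x+y≡0⇒x≡-y (x h) (y h) x+y≡0)))
             (trans y′≡-x (sym (x+y≡0⇒x≡-y (y h) (x h) (trans (ℚ.+-comm (y h) (x h)) x+y≡0)))))
      (λ Wv → let h , h′ , B , B′ , q , r = intersection-onto Wv
                  x′≡-y , y′≡-x = opposite-tail p h′
                  -- Now `y h′` is `- x h` and `x h′` is `- y h`, so `s` amounts to (x + y)² = 0.
                  s = isotropy-at-j {h} {h′} B B′ q
        in h , B , x-y≡0⇒x≡y (trans (gap h) (x*x≡0⇒x≡0 (square (x h) (y h) (x h′) (y h′)
             (trans (q (inj₁ j)) x′≡-y) (trans (q (inj₂ j)) y′≡-x) s))) , r)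
      where
      x+y≡0⇒x≡-y : ∀ a b → a + b ≡ 0ℚ → a ≡ - b
      x+y≡0⇒x≡-y a b p = x-y≡0⇒x≡y (trans (solve 2 (λ a b → a :- :- b := a :+ b) refl a b) p)
      gap : ∀ h → h (αᶠ M t) - h t ≡ x h + y h
      gap h = solve 3 (λ a b c → b :- a := (b :- c) :+ (c :- a)) refl (h t) (h (αᶠ M t)) (h (σ⁻¹ M t))
      square : ∀ a b a′ b′ → a ≡ - b′ → b ≡ - a′ → a * b′ + b * a′ ≡ a * b + b * a → (a + b) * (a + b) ≡ 0ℚ
      square _ _ a′ b′ refl refl s = trans
        (solve 2 (λ a b → (:- b :+ :- a) :* (:- b :+ :- a)
          := ((:- b :* :- a) :+ (:- a :* :- b)) :- ((:- b :* b) :+ (:- a :* a))) refl a′ b′)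
        (x≡y⇒x-y≡0 (sym s))

    isLagrangianPair : IsLagrangianPair (ι[H₁] M o) (ι[H₁] M′ o′)
    isLagrangianPair = record
      { lagrangian₁  = image-isLagrangian M o j
      ; lagrangian₂  = image-isLagrangian M′ o′ j
      ; intersection = predecessor j λ n≡ → intersection-dimension n≡
      }
      where
      -- The edge `j` witnesses that `n` is positive, which provides the `d` with `suc d ≡ n`.
      predecessor : ∀ {k} {D : ℕ → Set} → Fin k → (∀ {m} → k ≡ suc m → D m) → ∃[ d ] (suc d ≡ k × D d)
      predecessor {suc k} _ f = k , refl , f refl

theorem4p4 : ∀ (n : ℕ) (M : Map n) (j : Fin n)
    (o : Orientation M) (o′ : Orientation (partialDual M j)) →
    AgreeAwayFrom j o o′ →
    IsLagrangianPair (ι[H₁] M o) (ι[H₁] (partialDual M j) o′)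
theorem4p4 n M j o o′ = isLagrangianPair M j o o′
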